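{- Let $q=3^n$ with $n\ge 3$. Let \[ f(X)=aX+\frac{1}{X-r_1}+\frac{1}{X-r_2}+\frac{1}{X-r_3}, \] where $a\in\mathbb{F}_q^*$, $r\in\mathbb{F}_{q^3}\setminus\mathbb{F}_q$, and $r_1=r$, $r_2=r^q$, $r_3=r^{q^2}$. Then $f$ is a permutation rational function of $\mathbb{P}^1(\mathbb{F}_q)$ if and only if $r_1+r_2+r_3=0$ and $a=-(r_1-r_2)^{ -2}$.
   Context: $\mathbb{P}^1(\mathbb{F}_q)=\mathbb{F}_q\cup\{\infty\}$ is the projective line over $\mathbb{F}_q$. A rational function $f=P/Q\in\mathbb{F}_q(X)$ ($P,Q$ coprime) defines a map $\mathbb{P}^1(\mathbb{F}_q)\to\mathbb{P}^1(\mathbb{F}_q)$ in the usual way (zeros of $Q$ map to $\infty$, and $f(\infty)$ is the limiting value). A permutation rational function of $\mathbb{P}^1(\mathbb{F}_q)$ is a rational function whose induced map on $\mathbb{P}^1(\mathbb{F}_q)$ is a bijection. -}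

module Defs where

open import Level using (Level) renaming (suc to lsuc)
open import Data.Unit.Polymorphic using (⊤)
open import Data.Nat as ℕ using (ℕ; zero; suc)
open import Data.Fin using (Fin)
open import Data.Maybe using (Maybe; just; nothing)
open import Data.Product using (_×_; _,_; ∃-syntax)
open import Function.Bundles using (_↔_)
open import Relation.Nullary using (¬_; Dec; yes; no)
open import Relation.Binary.PropositionalEquality using (_≡_)
open import Relation.Binary.Definitions using (DecidableEquality)
open import Algebra.Structures using (IsCommutativeRing)

-- A field with propositional equality.  Inversion is a total operation
-- with the (harmless) convention 0⁻¹ = 0; it is only ever applied to
-- nonzero elements in the statement.
record Field (c : Level) : Set (lsuc c) where
  infixl 7 _*_
  infixl 6 _+_ _-_
  infix  8 -_
  infix  9 _⁻¹
  field
    Carrier : Set c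
    _+_ _*_ : Carrier → Carrier → Carrier
    -_      : Carrier → Carrier
    0# 1#   : Carrier
    _⁻¹     : Carrier → Carrier
    isCommutativeRing : IsCommutativeRing _≡_ _+_ _*_ -_ 0# 1#
    0≢1     : ¬ (0# ≡ 1#)
    ⁻¹-inverse : ∀ x → ¬ (x ≡ 0#) → x * (x ⁻¹) ≡ 1#
    ⁻¹-zero : 0# ⁻¹ ≡ 0#
    _≟_     : DecidableEquality Carrier

  _-_ : Carrier → Carrier → Carrier
  x - y = x + (- y)

  infixr 10 _^_
  _^_ : Carrier → ℕ → Carrier
  x ^ zero  = 1#
  x ^ suc k = x * (x ^ k)

HasCardinality : ∀ {c} → Field c → ℕ → Set c
HasCardinality K m = Field.Carrier K ↔ Fin m

module Setup {c} (K : Field c) (q : ℕ) (a r : Field.Carrier K) where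
  open Field K

  -- Elements of F_q inside K: the fixed points of x ↦ x^q.
  InFq : Carrier → Set c
  InFq x = x ^ q ≡ x

  -- Points of P¹(K) as  Maybe Carrier  (nothing = ∞);
  -- points of P¹(F_q) are ∞ and the elements of F_q.
  InP1Fq : Maybe Carrier → Set c
  InP1Fq nothing  = ⊤
  InP1Fq (just x) = InFq x

  r₁ r₂ r₃ : Carrier
  r₁ = r
  r₂ = r ^ q
  r₃ = r ^ (q ℕ.* q)

  -- The map induced on P¹ by f(X) = aX + 1/(X-r₁) + 1/(X-r₂) + 1/(X-r₃):
  -- the poles r₁, r₂, r₃ go to ∞, and since a ≠ 0 the numerator of
  -- f = P/Q (in lowest terms) has degree 4 > 3 = deg Q, so f(∞) = ∞.
  f : Maybe Carrier → Maybe Carrier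
  f nothing = nothing
  f (just x) with x ≟ r₁ | x ≟ r₂ | x ≟ r₃
  ... | yes _ | _     | _     = nothing
  ... | no _  | yes _ | _     = nothing
  ... | no _  | no _  | yes _ = nothing
  ... | no _  | no _  | no _  =
    just (a * x + (x - r₁) ⁻¹ + (x - r₂) ⁻¹ + (x - r₃) ⁻¹)

  IsPermutationP1Fq : Set c
  IsPermutationP1Fq =
    (∀ P → InP1Fq P → InP1Fq (f P)) ×
    (∀ Q → InP1Fq Q →
       ∃[ P ] (InP1Fq P × f P ≡ Q ×
               (∀ P′ → InP1Fq P′ → f P′ ≡ Q → P′ ≡ P)))

{-# OPTIONS --safe #-}
module Submission where

-- Write q = 3ⁿ, and let sums range over F_q.
--
-- "Only if".  A permutation f of F_q preserves all sums Σ G(x).  For r ∉ F_q one has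
-- (r - r^q)/(x - r) = (x - r)^(q-1) - 1 on F_q, whence Σ 1/(x - r)^j = (r^q - r)^(-j) for 1 ≤ j ≤ q.
-- Then Σ f(x) = 0 amounts to (r₁ + r₂ + r₃)² = 0.  Put δ = r₂ - r₁ ∈ F_q, ρ = r/δ (so ρ^q = ρ + 1), z = y - ρ and
-- h = 1/(z³ - z); then -δ f(δy) = by + h with b = -aδ².  The sums of (bz + h)⁵ and (bz + h)⁸ vanish,
-- which reads b² = b⁴ and b⁵ + b⁴ = b⁶ + b², so b = 1.  The exponent 8 is below q - 1 since n ≥ 3.
--
-- "If".  With L(X) = X³ - X, two points with the same value of y + h, at distance t ≠ 0, satisfy a quadratic
-- equation that puts L(z) in L(F_q), hence ρ in F_q.  So f is injective on the finite set F_q.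

open import Defs
open import Level using (Level)
open import Algebra.Bundles using (CommutativeRing; CommutativeMonoid; RawRing)
import Algebra.Properties.Ring as RingProperties
import Algebra.Properties.Semiring.Mult as SemiringMult
import Algebra.Solver.Ring as RingSolver
open import Algebra.Solver.Ring.AlmostCommutativeRing using (fromCommutativeRing; _-Raw-AlmostCommutative⟶_)
open import Data.List.Base using (List; []; _∷_; _++_; map; length; foldr; tabulate; filter)
open import Data.List.Membership.Propositional using (_∈_; find; lose)
open import Data.List.Membership.Propositional.Properties using (∈-map⁺; ∈-map⁻; ∈-++⁻; ∈-++⁺ˡ; ∈-++⁺ʳ; ∈-∃++; ∈-tabulate⁺; ∈-filter⁺; ∈-filter⁻)
open import Data.List.Membership.Propositional.Properties.WithK using (unique∧set⇒bag)
open import Data.List.Properties using (map-∘; length-map; length-tabulate; length-++-sucʳ)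
open import Data.List.Relation.Binary.BagAndSetEquality using (∼bag⇒↭)
open import Data.List.Relation.Binary.Permutation.Propositional using (_↭_; ↭⇒↭ₛ)
open import Data.List.Relation.Binary.Permutation.Propositional.Properties using (↭-length) renaming (map⁺ to ↭-map⁺)
open import Data.List.Relation.Binary.Permutation.Setoid.Properties using (foldr-commMonoid)
open import Data.List.Relation.Unary.All as All using (All; []; _∷_; all?)
open import Data.List.Relation.Unary.All.Properties as All using (all-filter; ¬All⇒Any¬)
open import Data.List.Relation.Unary.AllPairs using ([]; _∷_)
open import Data.List.Relation.Unary.Any using (here; there; any?)
open import Data.List.Relation.Unary.Unique.Propositional using (Unique)
open import Data.List.Relation.Unary.Unique.Propositional.Properties using (tabulate⁺; filter⁺)
open import Data.Maybe.Base using (Maybe; just; nothing)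
open import Data.Maybe.Properties using (just-injective)
open import Data.Nat.Base as ℕ using (ℕ; zero; suc)
import Data.Nat.Properties as ℕ
open import Data.Nat.Solver using (module +-*-Solver)
open import Data.Product using (_×_; _,_; proj₁; proj₂; ∃-syntax)
open import Data.Sum using (_⊎_; inj₁; inj₂)
open import Data.Vec.Base using (Vec; []; _∷_)
open import Function.Bundles using (_⇔_; mk⇔; Inverse)
open import Relation.Binary.PropositionalEquality
open import Relation.Nullary using (¬_; Dec; yes; no; contradiction; ¬?; from-yes)
open import Relation.Nullary.Decidable using (True; toWitness)
open import Relation.Unary using (Pred; Decidable)
open ≡-Reasoning

-- Why the exponents are 5 and 8. By z³h = zh + 1, each power (bz + h)^k reduces to pure powers of z
-- and monomials z^i h^j with i ≤ 2. The translation y ↦ y + 1 fixes h and moves z by 1; comparing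
-- sums before and after it kills the monomials with i ≤ 1. For i = 2 the comparison would need the
-- coefficient 3 = 0, so only the sums of z²h^j carry information, and partial fractions evaluate
-- them. The scaling by δ makes r^q - r equal to 1 at all three poles, so every reciprocal power
-- sums to 1 and each such sum is just a sum of coefficients in F₃. For k ≤ 4 nothing survives; k =
-- 5 gives b² = 1; k = 6 is the cube of k = 2; k = 7 gives b² = 1 again; k = 8 is the first exponent
-- to exclude b = -1. F_q is given only as the fixed points of x ↦ x^q in K, so before any power sum
-- is evaluated there must be a proof that at least q such points exist.

suc-cubed : ∀ p → let q = suc p in q ℕ.* (q ℕ.* q) ≡ suc (suc (q ℕ.* q ℕ.+ q) ℕ.* p)
suc-cubed = solve 1 (λ p → let q = con 1 :+ p in
  q :* (q :* q) := con 1 :+ (con 1 :+ (q :* q :+ q)) :* p) refl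
  where open +-*-Solver

-- Repetition-free lists, their permutations, and the pigeonhole principle.

module _ {a} {A : Set a} where

  unique-map⁺ : ∀ {b} {B : Set b} (g : A → B) {xs : List A} →
    (∀ {x y} → x ∈ xs → y ∈ xs → g x ≡ g y → x ≡ y) →
    Unique xs → Unique (map g xs)
  unique-map⁺ g inj []         = []
  unique-map⁺ g inj (x∉ ∷ uxs) =
    All.map⁺ (All.tabulate λ y∈ gx≡gy → All.lookup x∉ y∈ (inj (here refl) (there y∈) gx≡gy))
    ∷ unique-map⁺ g (λ x∈ y∈ → inj (there x∈) (there y∈)) uxs

  unique-same-elements⇒↭ : {xs ys : List A} → Unique xs → Unique ys →
    (∀ {z} → z ∈ xs → z ∈ ys) → (∀ {z} → z ∈ ys → z ∈ xs) → xs ↭ ys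
  unique-same-elements⇒↭ uxs uys to from = ∼bag⇒↭ (unique∧set⇒bag uxs uys (mk⇔ to from))

  bijection⇒map-↭ : {xs : List A} → Unique xs → (g g⁻ : A → A) →
    (∀ {x} → x ∈ xs → g x ∈ xs) → (∀ {x} → x ∈ xs → g⁻ x ∈ xs) →
    (∀ {x} → x ∈ xs → g⁻ (g x) ≡ x) → (∀ {x} → x ∈ xs → g (g⁻ x) ≡ x) →
    map g xs ↭ xs
  bijection⇒map-↭ {xs} uxs g g⁻ g∈ g⁻∈ g⁻g gg⁻ = unique-same-elements⇒↭
    (unique-map⁺ g (λ x∈ y∈ eq → trans (sym (g⁻g x∈)) (trans (cong g⁻ eq) (g⁻g y∈))) uxs)
    uxs
    (λ z∈ → let (y , y∈ , z≡gy) = ∈-map⁻ g z∈ in subst (_∈ xs) (sym z≡gy) (g∈ y∈))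
    (λ z∈ → subst (_∈ map g xs) (gg⁻ z∈) (∈-map⁺ g (g⁻∈ z∈)))

  -- Pigeonhole: the head is cut out of `ys` at one occurrence, and the tail avoids it because `xs`
  -- has no repetition. This later turns an injective self-map of F_q into a surjective one.
  unique-⊆⇒length-≤ : {xs ys : List A} → Unique xs → (∀ {x} → x ∈ xs → x ∈ ys) → length xs ℕ.≤ length ys
  unique-⊆⇒length-≤ []         _   = ℕ.z≤n
  unique-⊆⇒length-≤ (x∉ ∷ uxs) xs⊆ys with ∈-∃++ (xs⊆ys (here refl))
  ... | as , bs , refl = ℕ.≤-trans
    (ℕ.s≤s (unique-⊆⇒length-≤ uxs λ z∈ →
      avoid as (λ z≡x → All.lookup x∉ z∈ (sym z≡x)) (xs⊆ys (there z∈))))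
    (ℕ.≤-reflexive (sym (length-++-sucʳ as _ bs)))
    where
    avoid : ∀ as {x z} {bs : List A} → z ≢ x → z ∈ as ++ x ∷ bs → z ∈ as ++ bs
    avoid as z≢x z∈ with ∈-++⁻ as z∈
    ... | inj₁ z∈as          = ∈-++⁺ˡ z∈as
    ... | inj₂ (here z≡x)    = contradiction z≡x z≢x
    ... | inj₂ (there z∈bs)  = ∈-++⁺ʳ as z∈bs

-- Fields: cancellation, powers, finite sums and products.

module FieldProperties {c} (K : Field c) where

  open Field K public

  commutativeRing : CommutativeRing c c
  commutativeRing = record { isCommutativeRing = isCommutativeRing }

  open CommutativeRing commutativeRing public
    using ( +-assoc; +-comm; +-identityˡ; +-identityʳ; *-assoc; *-comm; *-identityˡ; *-identityʳ
          ; distribˡ; distribʳ; zeroˡ; zeroʳ; -‿inverseˡ; -‿inverseʳ; ring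
          ; +-commutativeMonoid; *-commutativeMonoid)
  open RingProperties ring public using (x∙y⁻¹≈ε⇒x≈y; +-cancelˡ)

  +-interchange : ∀ x y z w → (x + y) + (z + w) ≡ (x + z) + (y + w)
  +-interchange x y z w = begin
    (x + y) + (z + w) ≡⟨ +-assoc x y _ ⟩
    x + (y + (z + w))
      ≡⟨ cong (x +_) (trans (sym (+-assoc y z w)) (trans (cong (_+ w) (+-comm y z)) (+-assoc z y w))) ⟩
    x + (z + (y + w)) ≡⟨ +-assoc x z _ ⟨
    (x + z) + (y + w) ∎

  *-interchange : ∀ x y z w → (x * y) * (z * w) ≡ (x * z) * (y * w)
  *-interchange x y z w = begin
    (x * y) * (z * w) ≡⟨ *-assoc x y _ ⟩
    x * (y * (z * w))
      ≡⟨ cong (x *_) (trans (sym (*-assoc y z w)) (trans (cong (_* w) (*-comm y z)) (*-assoc z y w))) ⟩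
    x * (z * (y * w)) ≡⟨ *-assoc x z _ ⟨
    (x * z) * (y * w) ∎

  x≡y⇒x-y≡0 : ∀ {x y} → x ≡ y → x - y ≡ 0#
  x≡y⇒x-y≡0 {x} refl = -‿inverseʳ x

  x-y≡0⇒x≡y : ∀ {x y} → x - y ≡ 0# → x ≡ y
  x-y≡0⇒x≡y {x} {y} = x∙y⁻¹≈ε⇒x≈y x y

  x⁻¹*[x*y]≡y : ∀ {x} → x ≢ 0# → ∀ y → x ⁻¹ * (x * y) ≡ y
  x⁻¹*[x*y]≡y {x} x≢0 y = trans (sym (*-assoc _ _ _))
    (trans (cong (_* y) (trans (*-comm _ _) (⁻¹-inverse x x≢0))) (*-identityˡ y))

  x*[x⁻¹*y]≡y : ∀ {x} → x ≢ 0# → ∀ y → x * (x ⁻¹ * y) ≡ y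
  x*[x⁻¹*y]≡y {x} x≢0 y = trans (sym (*-assoc _ _ _))
    (trans (cong (_* y) (⁻¹-inverse x x≢0)) (*-identityˡ y))

  *-cancel-nonzeroˡ : ∀ {x y z} → x ≢ 0# → x * y ≡ x * z → y ≡ z
  *-cancel-nonzeroˡ {x} {y} {z} x≢0 eq = begin
    y              ≡⟨ x⁻¹*[x*y]≡y x≢0 y ⟨
    x ⁻¹ * (x * y) ≡⟨ cong (x ⁻¹ *_) eq ⟩
    x ⁻¹ * (x * z) ≡⟨ x⁻¹*[x*y]≡y x≢0 z ⟩
    z              ∎

  xy≡0⇒x≡0∨y≡0 : ∀ {x y} → x * y ≡ 0# → x ≡ 0# ⊎ y ≡ 0#
  xy≡0⇒x≡0∨y≡0 {x} {y} xy≡0 with x ≟ 0#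
  ... | yes x≡0 = inj₁ x≡0
  ... | no  x≢0 = inj₂ (*-cancel-nonzeroˡ x≢0 (trans xy≡0 (sym (zeroʳ x))))

  xy≡0∧x≢0⇒y≡0 : ∀ {x y} → x * y ≡ 0# → x ≢ 0# → y ≡ 0#
  xy≡0∧x≢0⇒y≡0 xy≡0 x≢0 with xy≡0⇒x≡0∨y≡0 xy≡0
  ... | inj₁ x≡0 = contradiction x≡0 x≢0
  ... | inj₂ y≡0 = y≡0

  *-nonzero : ∀ {x y} → x ≢ 0# → y ≢ 0# → x * y ≢ 0#
  *-nonzero x≢0 y≢0 xy≡0 = y≢0 (xy≡0∧x≢0⇒y≡0 xy≡0 x≢0)

  xy≡1⇒x≢0 : ∀ {x y} → x * y ≡ 1# → x ≢ 0#
  xy≡1⇒x≢0 {y = y} xy≡1 refl = 0≢1 (trans (sym (zeroˡ y)) xy≡1)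

  ⁻¹-unique : ∀ {x y} → x * y ≡ 1# → y ≡ x ⁻¹
  ⁻¹-unique {x} {y} xy≡1 = *-cancel-nonzeroˡ x≢0 (trans xy≡1 (sym (⁻¹-inverse x x≢0)))
    where x≢0 = xy≡1⇒x≢0 xy≡1

  ⁻¹-nonzero : ∀ {x} → x ≢ 0# → x ⁻¹ ≢ 0#
  ⁻¹-nonzero {x} x≢0 = xy≡1⇒x≢0 (trans (*-comm _ _) (⁻¹-inverse x x≢0))

  1^n≡1 : ∀ n → 1# ^ n ≡ 1#
  1^n≡1 zero    = refl
  1^n≡1 (suc n) = trans (*-identityˡ _) (1^n≡1 n)

  ^-+ : ∀ x m n → x ^ (m ℕ.+ n) ≡ x ^ m * x ^ n
  ^-+ x zero    n = sym (*-identityˡ _)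
  ^-+ x (suc m) n = trans (cong (x *_) (^-+ x m n)) (sym (*-assoc _ _ _))

  *-^ : ∀ x y n → (x * y) ^ n ≡ x ^ n * y ^ n
  *-^ x y zero    = sym (*-identityˡ _)
  *-^ x y (suc n) = trans (cong (x * y *_) (*-^ x y n)) (*-interchange x y _ _)

  ^-* : ∀ x m n → x ^ (m ℕ.* n) ≡ (x ^ n) ^ m
  ^-* x zero    n = refl
  ^-* x (suc m) n = trans (^-+ x n (m ℕ.* n)) (cong (x ^ n *_) (^-* x m n))

  ^-zero : ∀ x n → x ^ n ≡ 0# → x ≡ 0#
  ^-zero x zero    1≡0 = contradiction (sym 1≡0) 0≢1
  ^-zero x (suc n) eq with xy≡0⇒x≡0∨y≡0 eq
  ... | inj₁ x≡0  = x≡0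
  ... | inj₂ xⁿ≡0 = ^-zero x n xⁿ≡0

  ∑ : List Carrier → (Carrier → Carrier) → Carrier
  ∑ xs g = foldr _+_ 0# (map g xs)

  ∑-cong : ∀ xs {g h : Carrier → Carrier} → (∀ {x} → x ∈ xs → g x ≡ h x) → ∑ xs g ≡ ∑ xs h
  ∑-cong []       eq = refl
  ∑-cong (x ∷ xs) eq = cong₂ _+_ (eq (here refl)) (∑-cong xs (λ x∈ → eq (there x∈)))

  ∑-zero : ∀ xs → ∑ xs (λ _ → 0#) ≡ 0#
  ∑-zero []       = refl
  ∑-zero (x ∷ xs) = trans (+-identityˡ _) (∑-zero xs)

  ∑-+ : ∀ xs g h → ∑ xs (λ x → g x + h x) ≡ ∑ xs g + ∑ xs h
  ∑-+ []       g h = sym (+-identityˡ 0#)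
  ∑-+ (x ∷ xs) g h = trans (cong (g x + h x +_) (∑-+ xs g h)) (+-interchange (g x) (h x) _ _)

  ∑-* : ∀ xs k g → ∑ xs (λ x → k * g x) ≡ k * ∑ xs g
  ∑-* []       k g = sym (zeroʳ k)
  ∑-* (x ∷ xs) k g = trans (cong (k * g x +_) (∑-* xs k g)) (sym (distribˡ k _ _))

  ∑-permute : ∀ {xs} (σ : Carrier → Carrier) g → map σ xs ↭ xs → ∑ xs (λ x → g (σ x)) ≡ ∑ xs g
  ∑-permute {xs} σ g perm = begin
    foldr _+_ 0# (map (λ x → g (σ x)) xs) ≡⟨ cong (foldr _+_ 0#) (map-∘ xs) ⟩
    foldr _+_ 0# (map g (map σ xs))       ≡⟨ foldr-commMonoid M.setoid M.isCommutativeMonoid (↭⇒↭ₛ (↭-map⁺ g perm)) ⟩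
    foldr _+_ 0# (map g xs)               ∎
    where module M = CommutativeMonoid +-commutativeMonoid

  ∑-delta : ∀ {xs a} g → a ∈ xs → Unique xs → (∀ {x} → x ≢ a → g x ≡ 0#) → ∑ xs g ≡ g a
  ∑-delta {x ∷ xs} g (here refl) (x∉ ∷ uxs) g≡0 = trans
    (cong (g x +_) (trans (∑-cong xs (λ y∈ → g≡0 (λ y≡x → All.lookup x∉ y∈ (sym y≡x)))) (∑-zero xs)))
    (+-identityʳ _)
  ∑-delta {x ∷ xs} g (there a∈) (x∉ ∷ uxs) g≡0 = trans
    (cong₂ _+_ (g≡0 (All.lookup x∉ a∈)) (∑-delta g a∈ uxs g≡0))
    (+-identityˡ _)

  ∏ : List Carrier → Carrier
  ∏ = foldr _*_ 1#

  ∏-scale : ∀ k xs → ∏ (map (k *_) xs) ≡ k ^ length xs * ∏ xs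
  ∏-scale k []       = sym (*-identityˡ _)
  ∏-scale k (x ∷ xs) = trans (cong (k * x *_) (∏-scale k xs)) (*-interchange k x _ _)

  ∏-↭ : ∀ {xs ys} → xs ↭ ys → ∏ xs ≡ ∏ ys
  ∏-↭ perm = foldr-commMonoid M.setoid M.isCommutativeMonoid (↭⇒↭ₛ perm)
    where module M = CommutativeMonoid *-commutativeMonoid

  ∏-nonzero : ∀ xs → All (_≢ 0#) xs → ∏ xs ≢ 0#
  ∏-nonzero []       _              1≡0 = 0≢1 (sym 1≡0)
  ∏-nonzero (x ∷ xs) (x≢0 ∷ xs≢0) = *-nonzero x≢0 (∏-nonzero xs xs≢0)

-- Finite fields: Lagrange's theorem for the units, and the characteristic.

module FiniteField {c} (K : Field c) {N : ℕ} (card : HasCardinality K N) where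

  open FieldProperties K
  open SemiringMult (CommutativeRing.semiring commutativeRing) using (×1-homo-*) renaming (_×_ to _×ₙ_)

  private module card = Inverse card

  elements : List Carrier
  elements = tabulate card.from

  ∈-elements : ∀ x → x ∈ elements
  ∈-elements x = subst (_∈ elements) (card.strictlyInverseʳ x) (∈-tabulate⁺ (card.to x))

  elements-unique : Unique elements
  elements-unique = tabulate⁺ λ {i} {j} eq →
    trans (sym (card.strictlyInverseˡ i)) (trans (cong card.to eq) (card.strictlyInverseˡ j))

  length-elements : length elements ≡ N
  length-elements = length-tabulate card.from

  nonzero? : ∀ x → Dec (x ≢ 0#)
  nonzero? x = ¬? (x ≟ 0#)

  units : List Carrier
  units = filter nonzero? elements

  N≡1+units : N ≡ suc (length units)
  N≡1+units = trans (sym length-elements) (↭-length (unique-same-elements⇒↭ elements-unique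
    (All.map (λ x≢0 0≡x → x≢0 (sym 0≡x)) (all-filter nonzero? elements) ∷ filter⁺ nonzero? elements-unique)
    split (λ {z} _ → ∈-elements z)))
    where
    split : ∀ {z} → z ∈ elements → z ∈ 0# ∷ units
    split {z} z∈ with z ≟ 0#
    ... | yes refl = here refl
    ... | no  z≢0  = there (∈-filter⁺ nonzero? z∈ z≢0)

  -- Multiplication by `x` permutes the units, so their product is unchanged when it is multiplied
  -- by x^|units|; being nonzero, it cancels.
  x^units≡1 : ∀ {x} → x ≢ 0# → x ^ length units ≡ 1#
  x^units≡1 {x} x≢0 = *-cancel-nonzeroˡ (∏-nonzero units (all-filter nonzero? elements)) (begin
    ∏ units * x ^ length units  ≡⟨ *-comm _ _ ⟩
    x ^ length units * ∏ units  ≡⟨ ∏-scale x units ⟨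
    ∏ (map (x *_) units)        ≡⟨ ∏-↭ (bijection⇒map-↭ (filter⁺ nonzero? elements-unique) (x *_) (x ⁻¹ *_)
                                     (closed x≢0) (closed (⁻¹-nonzero x≢0))
                                     (λ {y} _ → x⁻¹*[x*y]≡y x≢0 y) (λ {y} _ → x*[x⁻¹*y]≡y x≢0 y)) ⟩
    ∏ units                     ≡⟨ *-identityʳ _ ⟨
    ∏ units * 1#                ∎)
    where
    closed : ∀ {k} → k ≢ 0# → ∀ {y} → y ∈ units → k * y ∈ units
    closed k≢0 y∈ = ∈-filter⁺ nonzero? (∈-elements _) (*-nonzero k≢0 (proj₂ (∈-filter⁻ nonzero? {xs = elements} y∈)))

  x^N≡x : ∀ x → x ^ N ≡ x
  x^N≡x x with x ≟ 0#
  ... | yes refl = trans (cong (0# ^_) N≡1+units) (zeroˡ _)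
  ... | no  x≢0  = begin
    x ^ N                ≡⟨ cong (x ^_) N≡1+units ⟩
    x * x ^ length units ≡⟨ cong (x *_) (x^units≡1 x≢0) ⟩
    x * 1#               ≡⟨ *-identityʳ x ⟩
    x                    ∎

  ∑1≡N×1 : ∀ xs → ∑ xs (λ _ → 1#) ≡ length xs ×ₙ 1#
  ∑1≡N×1 []       = refl
  ∑1≡N×1 (x ∷ xs) = cong (1# +_) (∑1≡N×1 xs)

  -- Translation by 1 preserves Σ x, while Σ (x + 1) = Σ x + Σ 1. The form with an arbitrary list
  -- closed under x ± 1 serves both the whole field and F_q.
  ∑1≡0 : ∀ xs → Unique xs → (∀ {x} → x ∈ xs → x + 1# ∈ xs) → (∀ {x} → x ∈ xs → x - 1# ∈ xs) →
    ∑ xs (λ _ → 1#) ≡ 0#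
  ∑1≡0 xs uxs +1∈ -1∈ = +-cancelˡ (∑ xs (λ x → x)) _ _ (begin
    ∑ xs (λ x → x) + ∑ xs (λ _ → 1#) ≡⟨ ∑-+ xs _ _ ⟨
    ∑ xs (λ x → x + 1#)              ≡⟨ ∑-permute (_+ 1#) (λ x → x) (bijection⇒map-↭ uxs (_+ 1#) (_- 1#) +1∈ -1∈
                                          (λ {x} _ → trans (+-assoc _ _ _) (trans (cong (x +_) (-‿inverseʳ 1#)) (+-identityʳ x)))
                                          (λ {x} _ → trans (+-assoc _ _ _) (trans (cong (x +_) (-‿inverseˡ 1#)) (+-identityʳ x)))) ⟩
    ∑ xs (λ x → x)                   ≡⟨ +-identityʳ _ ⟨
    ∑ xs (λ x → x) + 0#              ∎)

  -- The image of p^m in the field counts its elements and is 0 by translation; a field has no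
  -- nonzero nilpotents.
  characteristic : ∀ p m → N ≡ p ℕ.^ m → p ×ₙ 1# ≡ 0#
  characteristic p m N≡p^m = ^-zero _ m (begin
    (p ×ₙ 1#) ^ m        ≡⟨ power m ⟨
    (p ℕ.^ m) ×ₙ 1#      ≡⟨ cong (_×ₙ 1#) (trans length-elements N≡p^m) ⟨
    length elements ×ₙ 1# ≡⟨ ∑1≡N×1 elements ⟨
    ∑ elements (λ _ → 1#) ≡⟨ ∑1≡0 elements elements-unique (λ _ → ∈-elements _) (λ _ → ∈-elements _) ⟩
    0#                   ∎)
    where
    power : ∀ m → (p ℕ.^ m) ×ₙ 1# ≡ (p ×ₙ 1#) ^ m
    power zero    = +-identityʳ 1#
    power (suc m) = trans (×1-homo-* p (p ℕ.^ m)) (cong (p ×ₙ 1# *_) (power m))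

-- Characteristic 3 and a ring solver modulo 3.

HasCharacteristic3 : ∀ {c} → Field c → Set c
HasCharacteristic3 K = 1# + 1# + 1# ≡ 0#
  where open Field K

module Characteristic3 {c} (K : Field c) (3≡0 : HasCharacteristic3 K) where

  open FieldProperties K

  -- Coefficients in F₃ let the ring solver compute modulo 3.
  data F₃ : Set where
    𝟘 𝟙 𝟚 : F₃

  _+₃_ _*₃_ : F₃ → F₃ → F₃
  𝟘 +₃ y = y
  𝟙 +₃ 𝟘 = 𝟙
  𝟙 +₃ 𝟙 = 𝟚
  𝟙 +₃ 𝟚 = 𝟘
  𝟚 +₃ 𝟘 = 𝟚
  𝟚 +₃ 𝟙 = 𝟘
  𝟚 +₃ 𝟚 = 𝟙
  𝟘 *₃ y = 𝟘
  𝟙 *₃ y = y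
  𝟚 *₃ y = y +₃ y

  -₃_ : F₃ → F₃
  -₃ 𝟘 = 𝟘
  -₃ 𝟙 = 𝟚
  -₃ 𝟚 = 𝟙

  ⟦_⟧₃ : F₃ → Carrier
  ⟦ 𝟘 ⟧₃ = 0#
  ⟦ 𝟙 ⟧₃ = 1#
  ⟦ 𝟚 ⟧₃ = 1# + 1#

  1+2≡0 : 1# + (1# + 1#) ≡ 0#
  1+2≡0 = trans (sym (+-assoc 1# 1# 1#)) 3≡0

  ⟦⟧-+ : ∀ x y → ⟦ x +₃ y ⟧₃ ≡ ⟦ x ⟧₃ + ⟦ y ⟧₃
  ⟦⟧-+ 𝟘 y = sym (+-identityˡ _)
  ⟦⟧-+ 𝟙 𝟘 = sym (+-identityʳ _)
  ⟦⟧-+ 𝟙 𝟙 = refl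
  ⟦⟧-+ 𝟙 𝟚 = sym 1+2≡0
  ⟦⟧-+ 𝟚 𝟘 = sym (+-identityʳ _)
  ⟦⟧-+ 𝟚 𝟙 = sym 3≡0
  ⟦⟧-+ 𝟚 𝟚 = sym (trans (sym (+-assoc _ 1# 1#)) (trans (cong (_+ 1#) 3≡0) (+-identityˡ 1#)))

  ⟦⟧-* : ∀ x y → ⟦ x *₃ y ⟧₃ ≡ ⟦ x ⟧₃ * ⟦ y ⟧₃
  ⟦⟧-* 𝟘 y = sym (zeroˡ _)
  ⟦⟧-* 𝟙 y = sym (*-identityˡ _)
  ⟦⟧-* 𝟚 y = trans (⟦⟧-+ y y) (sym (trans (distribʳ ⟦ y ⟧₃ 1# 1#) (cong₂ _+_ (*-identityˡ _) (*-identityˡ _))))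

  ⟦⟧-neg : ∀ x → ⟦ -₃ x ⟧₃ ≡ - ⟦ x ⟧₃
  ⟦⟧-neg x = +-cancelˡ ⟦ x ⟧₃ _ _ (trans (x-x x) (sym (-‿inverseʳ _)))
    where
    x-x : ∀ x → ⟦ x ⟧₃ + ⟦ -₃ x ⟧₃ ≡ 0#
    x-x 𝟘 = +-identityˡ 0#
    x-x 𝟙 = 1+2≡0
    x-x 𝟚 = 3≡0

  _≟₃_ : ∀ x y → Maybe (⟦ x ⟧₃ ≡ ⟦ y ⟧₃)
  𝟘 ≟₃ 𝟘 = just refl
  𝟙 ≟₃ 𝟙 = just refl
  𝟚 ≟₃ 𝟚 = just refl
  _ ≟₃ _ = nothing

  F₃-rawRing : RawRing _ _
  F₃-rawRing = record { Carrier = F₃ ; _≈_ = _≡_ ; _+_ = _+₃_ ; _*_ = _*₃_ ; -_ = -₃_ ; 0# = 𝟘 ; 1# = 𝟙 }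

  F₃⟶K : F₃-rawRing -Raw-AlmostCommutative⟶ fromCommutativeRing commutativeRing
  F₃⟶K = record
    { ⟦_⟧ = ⟦_⟧₃ ; +-homo = ⟦⟧-+ ; *-homo = ⟦⟧-* ; -‿homo = ⟦⟧-neg ; 0-homo = refl ; 1-homo = refl }

  open RingSolver F₃-rawRing (fromCommutativeRing commutativeRing) F₃⟶K _≟₃_ public
    using (solve; _:=_; _:+_; _:*_; _:-_; :-_; con; Polynomial)

  -- Unfolds exactly as the field's own `_^_` does, so solver expressions agree definitionally with
  -- the powers written in the goals.
  infixr 10 _:^^_
  _:^^_ : ∀ {m} → Polynomial m → ℕ → Polynomial m
  x :^^ zero  = con 𝟙
  x :^^ suc k = x :* (x :^^ k)

  -- Root counting for monic polynomials.

  -- The Horner value of a monic polynomial of degree d, given by its d lower coefficients.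
  monic : ∀ {d} → Vec Carrier d → Carrier → Carrier
  monic []       x = 1#
  monic (k ∷ ks) x = k + x * monic ks x

  -- Synthetic division: the value at α of the Horner tail becomes the constant coefficient of the
  -- quotient.
  monic-divide : ∀ {d} (ks : Vec Carrier (suc d)) α →
    ∃[ ls ] (∀ x → monic ks x ≡ (x - α) * monic {d} ls x + monic ks α)
  monic-divide (k ∷ [])          α = [] , λ x →
    solve 3 (λ k x α → k :+ x :* con 𝟙 := (x :- α) :* con 𝟙 :+ (k :+ α :* con 𝟙)) refl k x α
  monic-divide (k ∷ ks@(_ ∷ _)) α with monic-divide ks α
  ... | ls , eq = monic ks α ∷ ls , λ x → trans (cong (λ t → k + x * t) (eq x))
    (solve 5 (λ k x α m e → k :+ x :* ((x :- α) :* m :+ e) := (x :- α) :* (e :+ x :* m) :+ (k :+ α :* e))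
      refl k x α (monic ls x) (monic ks α))

  roots≤degree : ∀ {d} (ks : Vec Carrier d) {xs} → Unique xs → All (λ x → monic ks x ≡ 0#) xs → length xs ℕ.≤ d
  roots≤degree ks       []         []         = ℕ.z≤n
  roots≤degree []       (_ ∷ _)    (1≡0 ∷ _)  = contradiction (sym 1≡0) 0≢1
  roots≤degree ks@(_ ∷ _) {x ∷ xs} (x∉ ∷ uxs) (x-root ∷ roots) with monic-divide ks x
  ... | ls , eq = ℕ.s≤s (roots≤degree ls uxs (All.map reduce (All.zip (x∉ , roots))))
    where
    reduce : ∀ {y} → x ≢ y × monic ks y ≡ 0# → monic ls y ≡ 0#
    reduce {y} (x≢y , y-root) = xy≡0∧x≢0⇒y≡0
      (begin
        (y - x) * monic ls y               ≡⟨ +-identityʳ _ ⟨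
        (y - x) * monic ls y + 0#          ≡⟨ cong ((y - x) * monic ls y +_) x-root ⟨
        (y - x) * monic ls y + monic ks x  ≡⟨ eq y ⟨
        monic ks y                         ≡⟨ y-root ⟩
        0#                                 ∎)
      (λ y-x≡0 → x≢y (sym (x-y≡0⇒x≡y y-x≡0)))

  -- Only the existence of coefficients enters the root bound; this lets a polynomial function keep
  -- whatever shape a computation gives it.
  Monic : ℕ → (Carrier → Carrier) → Set c
  Monic d g = ∃[ ks ] (∀ x → g x ≡ monic {d} ks x)

  monic-1 : Monic 0 (λ _ → 1#)
  monic-1 = [] , λ _ → refl

  monic-step : ∀ {d g} k → Monic d g → Monic (suc d) (λ x → k + x * g x)
  monic-step k (ks , eq) = k ∷ ks , λ x → cong (λ t → k + x * t) (eq x)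

  monic-cong : ∀ {d g h} → (∀ x → g x ≡ h x) → Monic d h → Monic d g
  monic-cong g≗h (ks , eq) = ks , λ x → trans (g≗h x) (eq x)

  monic-^* : ∀ m {d g} → Monic d g → Monic (m ℕ.+ d) (λ x → x ^ m * g x)
  monic-^* zero    Mg = monic-cong (λ x → *-identityˡ _) Mg
  monic-^* (suc m) Mg = monic-cong (λ x → trans (*-assoc _ _ _) (sym (+-identityˡ _))) (monic-step 0# (monic-^* m Mg))

  Monic-roots≤degree : ∀ {d g xs} → Monic d g → Unique xs → All (λ x → g x ≡ 0#) xs → length xs ℕ.≤ d
  Monic-roots≤degree (ks , eq) uxs roots =
    roots≤degree ks uxs (All.map (λ {x} gx≡0 → trans (sym (eq x)) gx≡0) roots)

  -- `J` is the degree, so there are `suc J` terms. With y = x^(q-1) and J = q² + q this is the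
  -- quotient of x^(q³-1) - 1 by x^(q-1) - 1.
  geometric : Carrier → ℕ → Carrier
  geometric y zero    = 1#
  geometric y (suc J) = 1# + y * geometric y J

  geometric-sum : ∀ y J → (y - 1#) * geometric y J ≡ y ^ suc J - 1#
  geometric-sum y zero    = solve 1 (λ y → (y :- con 𝟙) :* con 𝟙 := y :* con 𝟙 :- con 𝟙) refl y
  geometric-sum y (suc J) = begin
    (y - 1#) * (1# + y * geometric y J)
      ≡⟨ solve 2 (λ y g → (y :- con 𝟙) :* (con 𝟙 :+ y :* g) := (y :- con 𝟙) :+ y :* ((y :- con 𝟙) :* g)) refl y _ ⟩
    (y - 1#) + y * ((y - 1#) * geometric y J) ≡⟨ cong (λ t → (y - 1#) + y * t) (geometric-sum y J) ⟩
    (y - 1#) + y * (y ^ suc J - 1#)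
      ≡⟨ solve 2 (λ y t → (y :- con 𝟙) :+ y :* (t :- con 𝟙) := y :* t :- con 𝟙) refl y _ ⟩
    y ^ suc (suc J) - 1#                      ∎

  monic-geometric : ∀ m J → Monic (J ℕ.* suc m) (λ x → geometric (x ^ suc m) J)
  monic-geometric m zero    = monic-1
  monic-geometric m (suc J) = monic-cong (λ x → cong (1# +_) (*-assoc _ _ _))
    (monic-step 1# (monic-^* m (monic-geometric m J)))

  -- Additivity of the Frobenius map.

  cube-+ : ∀ x y → (x + y) ^ 3 ≡ x ^ 3 + y ^ 3
  cube-+ = solve 2 (λ x y → (x :+ y) :^^ 3 := x :^^ 3 :+ y :^^ 3) refl

  frobenius-+ : ∀ n x y → (x + y) ^ (3 ℕ.^ n) ≡ x ^ (3 ℕ.^ n) + y ^ (3 ℕ.^ n)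
  frobenius-+ zero    x y = solve 2 (λ x y → (x :+ y) :^^ 1 := x :^^ 1 :+ y :^^ 1) refl x y
  frobenius-+ (suc n) x y = begin
    (x + y) ^ (3 ℕ.* 3 ℕ.^ n)                   ≡⟨ ^-* (x + y) 3 (3 ℕ.^ n) ⟩
    ((x + y) ^ (3 ℕ.^ n)) ^ 3                   ≡⟨ cong (_^ 3) (frobenius-+ n x y) ⟩
    (x ^ (3 ℕ.^ n) + y ^ (3 ℕ.^ n)) ^ 3         ≡⟨ cube-+ _ _ ⟩
    (x ^ (3 ℕ.^ n)) ^ 3 + (y ^ (3 ℕ.^ n)) ^ 3   ≡⟨ cong₂ _+_ (^-* x 3 (3 ℕ.^ n)) (^-* y 3 (3 ℕ.^ n)) ⟨
    x ^ (3 ℕ.* 3 ℕ.^ n) + y ^ (3 ℕ.* 3 ℕ.^ n)   ∎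

  -- The roots of X³ - X form the prime field, which lies in F_q; this places the kernel of X³ - X
  -- in F_q.
  cube-fixed⇒frobenius-fixed : ∀ n {x} → x ^ 3 ≡ x → x ^ (3 ℕ.^ n) ≡ x
  cube-fixed⇒frobenius-fixed zero    {x} _    = *-identityʳ x
  cube-fixed⇒frobenius-fixed (suc n) {x} x³≡x =
    trans (^-* x 3 (3 ℕ.^ n)) (trans (cong (λ t → t ^ 3) (cube-fixed⇒frobenius-fixed n x³≡x)) x³≡x)

  -- The principal part at one pole: `x` stands for the reciprocal of the distance to the pole,
  -- there is no constant term, and the head coefficient belongs to the exponent `suc j`.
  -- Coefficients in F₃ let their sum be found by evaluation.
  principal : ℕ → List F₃ → Carrier → Carrier
  principal j []       x = 0#
  principal j (k ∷ ks) x = ⟦ k ⟧₃ * x ^ suc j + principal (suc j) ks x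

  :principal : ∀ {m} → ℕ → List F₃ → Polynomial m → Polynomial m
  :principal j []       x = con 𝟘
  :principal j (k ∷ ks) x = con k :* x :^^ suc j :+ :principal (suc j) ks x

  -- Partial fractions of 1/(z³ - z) and of z²h^j.

  -- The hypotheses say u = 1/z, v = 1/(z - 1) and w = 1/(z + 1).
  module PartialFractions {z u v w : Carrier}
    (zu≡1 : z * u ≡ 1#) (zv≡1+v : z * v ≡ 1# + v) (zw≡1-w : z * w ≡ 1# - w) where

    -- This is 1/(z³ - z): the derivative of z³ - z is -1 in characteristic 3, so the residue at
    -- each of the three poles is -1.
    h : Carrier
    h = - (u + v + w)

    -- 1/(z(z - 1)) = 1/(z - 1) - 1/z. Terms are added and subtracted until every z stands next to a
    -- reciprocal and a hypothesis applies.
    uv≡v-u : u * v ≡ v - u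
    uv≡v-u = begin
      u * v
        ≡⟨ solve 3 (λ z u v → u :* v := (u :* (con 𝟙 :+ v) :- (z :* u) :* v) :+ (z :* u) :* v :- u) refl z u v ⟩
      u * (1# + v) - (z * u) * v + (z * u) * v - u
        ≡⟨ cong₂ (λ s t → u * s - (z * u) * v + t * v - u) (sym zv≡1+v) zu≡1 ⟩
      u * (z * v) - (z * u) * v + 1# * v - u
        ≡⟨ solve 3 (λ z u v → u :* (z :* v) :- (z :* u) :* v :+ con 𝟙 :* v :- u := v :- u) refl z u v ⟩
      v - u                  ∎

    uw≡u-w : u * w ≡ u - w
    uw≡u-w = begin
      u * w
        ≡⟨ solve 3 (λ z u w → u :* w := (z :* u) :* w :- u :* (con 𝟙 :- w) :- (z :* u) :* w :+ u) refl z u w ⟩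
      (z * u) * w - u * (1# - w) - (z * u) * w + u
        ≡⟨ cong₂ (λ s t → (z * u) * w - u * s - t * w + u) (sym zw≡1-w) zu≡1 ⟩
      (z * u) * w - u * (z * w) - 1# * w + u
        ≡⟨ solve 3 (λ z u w → (z :* u) :* w :- u :* (z :* w) :- con 𝟙 :* w :+ u := u :- w) refl z u w ⟩
      u - w                  ∎

    -- The poles 1 and -1 are at distance 2, and the resulting factor 1/2 equals -1.
    vw≡w-v : v * w ≡ w - v
    vw≡w-v = begin
      v * w
        ≡⟨ solve 2 (λ v w → v :* w := v :* (con 𝟙 :- w) :- (con 𝟙 :+ v) :* w :+ (w :- v)) refl v w ⟩
      v * (1# - w) - (1# + v) * w + (w - v) ≡⟨ cong₂ (λ s t → v * s - t * w + (w - v)) zw≡1-w zv≡1+v ⟨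
      v * (z * w) - (z * v) * w + (w - v)
        ≡⟨ solve 3 (λ z v w → v :* (z :* w) :- (z :* v) :* w :+ (w :- v) := w :- v) refl z v w ⟩
      w - v                               ∎

    h*[z³-z]≡1 : h * (z * (z * z) - z) ≡ 1#
    h*[z³-z]≡1 = begin
      h * (z * (z * z) - z)
        ≡⟨ solve 4 (λ z u v w → (:- (u :+ v :+ w)) :* (z :* (z :* z) :- z)
             := :- ((z :* u) :* (z :* z :- con 𝟙) :+ (z :* v) :* (z :* z :- con 𝟙) :+ (z :* w) :* (z :* z :- con 𝟙))) refl z u v w ⟩
      - ((z * u) * (z * z - 1#) + (z * v) * (z * z - 1#) + (z * w) * (z * z - 1#))
        ≡⟨ cong₂ (λ s t → - ((z * u) * (z * z - 1#) + s * (z * z - 1#) + t * (z * z - 1#))) zv≡1+v zw≡1-w ⟩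
      - ((z * u) * (z * z - 1#) + (1# + v) * (z * z - 1#) + (1# - w) * (z * z - 1#))
        ≡⟨ solve 4 (λ z u v w → :- ((z :* u) :* (z :* z :- con 𝟙) :+ (con 𝟙 :+ v) :* (z :* z :- con 𝟙) :+ (con 𝟙 :- w) :* (z :* z :- con 𝟙))
             := :- (((z :* u) :+ con 𝟙 :+ con 𝟙) :* (z :* z :- con 𝟙) :+ z :* (z :* v) :- v :- z :* (z :* w) :+ w)) refl z u v w ⟩
      - ((z * u + 1# + 1#) * (z * z - 1#) + z * (z * v) - v - z * (z * w) + w)
        ≡⟨ cong₂ (λ s t → - ((z * u + 1# + 1#) * (z * z - 1#) + z * s - v - z * t + w)) zv≡1+v zw≡1-w ⟩
      - ((z * u + 1# + 1#) * (z * z - 1#) + z * (1# + v) - v - z * (1# - w) + w)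
        ≡⟨ solve 4 (λ z u v w → :- (((z :* u) :+ con 𝟙 :+ con 𝟙) :* (z :* z :- con 𝟙) :+ z :* (con 𝟙 :+ v) :- v :- z :* (con 𝟙 :- w) :+ w)
             := :- (((z :* u) :+ con 𝟙 :+ con 𝟙) :* (z :* z :- con 𝟙) :+ z :* v :- v :+ z :* w :+ w)) refl z u v w ⟩
      - ((z * u + 1# + 1#) * (z * z - 1#) + z * v - v + z * w + w)
        ≡⟨ cong₂ (λ s t → - ((z * u + 1# + 1#) * (z * z - 1#) + s - v + t + w)) zv≡1+v zw≡1-w ⟩
      - ((z * u + 1# + 1#) * (z * z - 1#) + (1# + v) - v + (1# - w) + w)
        ≡⟨ cong (λ s → - ((s + 1# + 1#) * (z * z - 1#) + (1# + v) - v + (1# - w) + w)) zu≡1 ⟩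
      - ((1# + 1# + 1#) * (z * z - 1#) + (1# + v) - v + (1# - w) + w)
        ≡⟨ solve 3 (λ z v w → :- ((con 𝟙 :+ con 𝟙 :+ con 𝟙) :* (z :* z :- con 𝟙) :+ (con 𝟙 :+ v) :- v :+ (con 𝟙 :- w) :+ w)
             := con 𝟙) refl z v w ⟩
      1# ∎

    -- The mixed products telescope: (v - u) + (u - w) + (w - v) = 0.
    h²≡u²+v²+w² : h * h ≡ u * u + v * v + w * w
    h²≡u²+v²+w² = begin
      h * h
        ≡⟨ solve 3 (λ u v w → (:- (u :+ v :+ w)) :* (:- (u :+ v :+ w))
             := u :* u :+ v :* v :+ w :* w :- (u :* v :+ u :* w :+ v :* w)) refl u v w ⟩
      u * u + v * v + w * w - (u * v + u * w + v * w)
        ≡⟨ cong₂ (λ s t → u * u + v * v + w * w - (s + t)) (cong₂ _+_ uv≡v-u uw≡u-w) vw≡w-v ⟩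
      u * u + v * v + w * w - ((v - u) + (u - w) + (w - v))
        ≡⟨ solve 3 (λ u v w → u :* u :+ v :* v :+ w :* w :- ((v :- u) :+ (u :- w) :+ (w :- v))
             := u :* u :+ v :* v :+ w :* w) refl u v w ⟩
      u * u + v * v + w * w ∎

    -- Here the mixed terms are squares of differences. Modulo 3, minus their sum is (u + v + w)²,
    -- which is the extra h².
    h⁴≡u⁴+v⁴+w⁴+h² : (h * h) * (h * h) ≡ u ^ 4 + v ^ 4 + w ^ 4 + h * h
    h⁴≡u⁴+v⁴+w⁴+h² = begin
      (h * h) * (h * h)
        ≡⟨ cong (λ t → t * t) h²≡u²+v²+w² ⟩
      (u * u + v * v + w * w) * (u * u + v * v + w * w)
        ≡⟨ solve 3 (λ u v w → (u :* u :+ v :* v :+ w :* w) :* (u :* u :+ v :* v :+ w :* w)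
             := u :^^ 4 :+ v :^^ 4 :+ w :^^ 4 :- ((u :* v) :* (u :* v) :+ (u :* w) :* (u :* w) :+ (v :* w) :* (v :* w))) refl u v w ⟩
      u ^ 4 + v ^ 4 + w ^ 4 - ((u * v) * (u * v) + (u * w) * (u * w) + (v * w) * (v * w))
        ≡⟨ cong₂ (λ s t → u ^ 4 + v ^ 4 + w ^ 4 - (s + t * t)) (cong₂ (λ s t → s * s + t * t) uv≡v-u uw≡u-w) vw≡w-v ⟩
      u ^ 4 + v ^ 4 + w ^ 4 - ((v - u) * (v - u) + (u - w) * (u - w) + (w - v) * (w - v))
        ≡⟨ solve 3 (λ u v w → u :^^ 4 :+ v :^^ 4 :+ w :^^ 4 :- ((v :- u) :* (v :- u) :+ (u :- w) :* (u :- w) :+ (w :- v) :* (w :- v))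
             := u :^^ 4 :+ v :^^ 4 :+ w :^^ 4 :+ (:- (u :+ v :+ w)) :* (:- (u :+ v :+ w))) refl u v w ⟩
      u ^ 4 + v ^ 4 + w ^ 4 + h * h ∎

    -- In each z²h^j the two factors z are attached to a single reciprocal. The results are then
    -- expansions of u^k, (1 + v)²v^k and (1 - w)²w^k, from which the coefficient lists are read
    -- off.
    substitute : ∀ (F : Carrier → Carrier → Carrier → Carrier) → F (z * u) (z * v) (z * w) ≡ F 1# (1# + v) (1# - w)
    substitute F = trans (cong (λ s → F s (z * v) (z * w)) zu≡1) (cong₂ (F 1#) zv≡1+v zw≡1-w)

    z²h : z ^ 2 * h ≡ principal 0 [] u + principal 0 (𝟚 ∷ []) v + principal 0 (𝟚 ∷ []) w
    z²h = begin
      z ^ 2 * h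
        ≡⟨ solve 4 (λ z u v w → z :^^ 2 :* (:- (u :+ v :+ w))
             := :- (z :* (z :* u :+ z :* v :+ z :* w))) refl z u v w ⟩
      - (z * (z * u + z * v + z * w)) ≡⟨ substitute (λ P Q R → - (z * (P + Q + R))) ⟩
      - (z * (1# + (1# + v) + (1# - w)))
        ≡⟨ solve 3 (λ z v w → :- (z :* (con 𝟙 :+ (con 𝟙 :+ v) :+ (con 𝟙 :- w))) := :- (z :* v) :+ z :* w) refl z v w ⟩
      - (z * v) + z * w ≡⟨ substitute (λ _ Q R → - Q + R) ⟩
      - (1# + v) + (1# - w)
        ≡⟨ solve 3 (λ u v w → :- (con 𝟙 :+ v) :+ (con 𝟙 :- w)
             := :principal 0 [] u :+ :principal 0 (𝟚 ∷ []) v :+ :principal 0 (𝟚 ∷ []) w) refl u v w ⟩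
      principal 0 [] u + principal 0 (𝟚 ∷ []) v + principal 0 (𝟚 ∷ []) w ∎

    z²h² : z ^ 2 * h ^ 2 ≡ principal 0 [] u + principal 0 (𝟚 ∷ 𝟙 ∷ []) v + principal 0 (𝟙 ∷ 𝟙 ∷ []) w
    z²h² = begin
      z ^ 2 * h ^ 2 ≡⟨ cong (λ t → z ^ 2 * (h * t)) (*-identityʳ h) ⟩
      z ^ 2 * (h * h) ≡⟨ cong (z ^ 2 *_) h²≡u²+v²+w² ⟩
      z ^ 2 * (u * u + v * v + w * w)
        ≡⟨ solve 4 (λ z u v w → z :^^ 2 :* (u :* u :+ v :* v :+ w :* w)
             := (z :* u) :^^ 2 :+ (z :* v) :^^ 2 :+ (z :* w) :^^ 2) refl z u v w ⟩
      (z * u) ^ 2 + (z * v) ^ 2 + (z * w) ^ 2 ≡⟨ substitute (λ P Q R → P ^ 2 + Q ^ 2 + R ^ 2) ⟩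
      1# ^ 2 + (1# + v) ^ 2 + (1# - w) ^ 2
        ≡⟨ solve 3 (λ u v w → con 𝟙 :^^ 2 :+ (con 𝟙 :+ v) :^^ 2 :+ (con 𝟙 :- w) :^^ 2
             := :principal 0 [] u :+ :principal 0 (𝟚 ∷ 𝟙 ∷ []) v :+ :principal 0 (𝟙 ∷ 𝟙 ∷ []) w) refl u v w ⟩
      principal 0 [] u + principal 0 (𝟚 ∷ 𝟙 ∷ []) v + principal 0 (𝟙 ∷ 𝟙 ∷ []) w ∎

    -- Cubing is additive, so h³ has no mixed products.
    z²h³ : z ^ 2 * h ^ 3 ≡ principal 0 (𝟚 ∷ []) u + principal 0 (𝟚 ∷ 𝟙 ∷ 𝟚 ∷ []) v + principal 0 (𝟚 ∷ 𝟚 ∷ 𝟚 ∷ []) w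
    z²h³ = begin
      z ^ 2 * h ^ 3
        ≡⟨ solve 4 (λ z u v w → z :^^ 2 :* (:- (u :+ v :+ w)) :^^ 3
             := :- ((z :* u) :^^ 2 :* u :+ (z :* v) :^^ 2 :* v :+ (z :* w) :^^ 2 :* w)) refl z u v w ⟩
      - ((z * u) ^ 2 * u + (z * v) ^ 2 * v + (z * w) ^ 2 * w)
        ≡⟨ substitute (λ P Q R → - (P ^ 2 * u + Q ^ 2 * v + R ^ 2 * w)) ⟩
      - (1# ^ 2 * u + (1# + v) ^ 2 * v + (1# - w) ^ 2 * w)
        ≡⟨ solve 3 (λ u v w → :- (con 𝟙 :^^ 2 :* u :+ (con 𝟙 :+ v) :^^ 2 :* v :+ (con 𝟙 :- w) :^^ 2 :* w)
             := :principal 0 (𝟚 ∷ []) u :+ :principal 0 (𝟚 ∷ 𝟙 ∷ 𝟚 ∷ []) v :+ :principal 0 (𝟚 ∷ 𝟚 ∷ 𝟚 ∷ []) w) refl u v w ⟩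
      principal 0 (𝟚 ∷ []) u + principal 0 (𝟚 ∷ 𝟙 ∷ 𝟚 ∷ []) v + principal 0 (𝟚 ∷ 𝟚 ∷ 𝟚 ∷ []) w ∎

    z²h⁴ : z ^ 2 * h ^ 4 ≡ principal 0 (𝟘 ∷ 𝟙 ∷ []) u + principal 0 (𝟚 ∷ 𝟚 ∷ 𝟚 ∷ 𝟙 ∷ []) v + principal 0 (𝟙 ∷ 𝟚 ∷ 𝟙 ∷ 𝟙 ∷ []) w
    z²h⁴ = begin
      z ^ 2 * h ^ 4 ≡⟨ solve 2 (λ z h → z :^^ 2 :* h :^^ 4 := z :^^ 2 :* ((h :* h) :* (h :* h))) refl z h ⟩
      z ^ 2 * ((h * h) * (h * h)) ≡⟨ cong (z ^ 2 *_) h⁴≡u⁴+v⁴+w⁴+h² ⟩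
      z ^ 2 * (u ^ 4 + v ^ 4 + w ^ 4 + h * h)
        ≡⟨ solve 5 (λ z u v w h → z :^^ 2 :* (u :^^ 4 :+ v :^^ 4 :+ w :^^ 4 :+ h :* h)
             := (z :* u) :^^ 2 :* u :^^ 2 :+ (z :* v) :^^ 2 :* v :^^ 2 :+ (z :* w) :^^ 2 :* w :^^ 2 :+ z :^^ 2 :* h :^^ 2) refl z u v w h ⟩
      (z * u) ^ 2 * u ^ 2 + (z * v) ^ 2 * v ^ 2 + (z * w) ^ 2 * w ^ 2 + z ^ 2 * h ^ 2
        ≡⟨ cong₂ _+_ (substitute (λ P Q R → P ^ 2 * u ^ 2 + Q ^ 2 * v ^ 2 + R ^ 2 * w ^ 2)) z²h² ⟩
      1# ^ 2 * u ^ 2 + (1# + v) ^ 2 * v ^ 2 + (1# - w) ^ 2 * w ^ 2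
        + (principal 0 [] u + principal 0 (𝟚 ∷ 𝟙 ∷ []) v + principal 0 (𝟙 ∷ 𝟙 ∷ []) w)
        ≡⟨ solve 3 (λ u v w → con 𝟙 :^^ 2 :* u :^^ 2 :+ (con 𝟙 :+ v) :^^ 2 :* v :^^ 2 :+ (con 𝟙 :- w) :^^ 2 :* w :^^ 2
               :+ (:principal 0 [] u :+ :principal 0 (𝟚 ∷ 𝟙 ∷ []) v :+ :principal 0 (𝟙 ∷ 𝟙 ∷ []) w)
             := :principal 0 (𝟘 ∷ 𝟙 ∷ []) u :+ :principal 0 (𝟚 ∷ 𝟚 ∷ 𝟚 ∷ 𝟙 ∷ []) v :+ :principal 0 (𝟙 ∷ 𝟚 ∷ 𝟙 ∷ 𝟙 ∷ []) w) refl u v w ⟩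
      principal 0 (𝟘 ∷ 𝟙 ∷ []) u + principal 0 (𝟚 ∷ 𝟚 ∷ 𝟚 ∷ 𝟙 ∷ []) v + principal 0 (𝟙 ∷ 𝟚 ∷ 𝟙 ∷ 𝟙 ∷ []) w ∎

    -- h⁶ is the cube of h² = u² + v² + w², and cubing is additive, so again no mixed products
    -- arise.
    z²h⁶ : z ^ 2 * h ^ 6 ≡ principal 0 (𝟘 ∷ 𝟘 ∷ 𝟘 ∷ 𝟙 ∷ []) u + principal 0 (𝟘 ∷ 𝟘 ∷ 𝟘 ∷ 𝟙 ∷ 𝟚 ∷ 𝟙 ∷ []) v + principal 0 (𝟘 ∷ 𝟘 ∷ 𝟘 ∷ 𝟙 ∷ 𝟙 ∷ 𝟙 ∷ []) w
    z²h⁶ = begin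
      z ^ 2 * h ^ 6
        ≡⟨ solve 2 (λ z h → z :^^ 2 :* h :^^ 6 := z :^^ 2 :* ((h :* h) :* ((h :* h) :* (h :* h)))) refl z h ⟩
      z ^ 2 * ((h * h) * ((h * h) * (h * h))) ≡⟨ cong (λ t → z ^ 2 * (t * (t * t))) h²≡u²+v²+w² ⟩
      z ^ 2 * (s * (s * s))
        ≡⟨ solve 4 (λ z u v w → let s = u :* u :+ v :* v :+ w :* w in z :^^ 2 :* (s :* (s :* s))
             := (z :* u) :^^ 2 :* u :^^ 4 :+ (z :* v) :^^ 2 :* v :^^ 4 :+ (z :* w) :^^ 2 :* w :^^ 4) refl z u v w ⟩
      (z * u) ^ 2 * u ^ 4 + (z * v) ^ 2 * v ^ 4 + (z * w) ^ 2 * w ^ 4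
        ≡⟨ substitute (λ P Q R → P ^ 2 * u ^ 4 + Q ^ 2 * v ^ 4 + R ^ 2 * w ^ 4) ⟩
      1# ^ 2 * u ^ 4 + (1# + v) ^ 2 * v ^ 4 + (1# - w) ^ 2 * w ^ 4
        ≡⟨ solve 3 (λ u v w → con 𝟙 :^^ 2 :* u :^^ 4 :+ (con 𝟙 :+ v) :^^ 2 :* v :^^ 4 :+ (con 𝟙 :- w) :^^ 2 :* w :^^ 4
             := :principal 0 (𝟘 ∷ 𝟘 ∷ 𝟘 ∷ 𝟙 ∷ []) u :+ :principal 0 (𝟘 ∷ 𝟘 ∷ 𝟘 ∷ 𝟙 ∷ 𝟚 ∷ 𝟙 ∷ []) v :+ :principal 0 (𝟘 ∷ 𝟘 ∷ 𝟘 ∷ 𝟙 ∷ 𝟙 ∷ 𝟙 ∷ []) w) refl u v w ⟩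
      principal 0 (𝟘 ∷ 𝟘 ∷ 𝟘 ∷ 𝟙 ∷ []) u + principal 0 (𝟘 ∷ 𝟘 ∷ 𝟘 ∷ 𝟙 ∷ 𝟚 ∷ 𝟙 ∷ []) v + principal 0 (𝟘 ∷ 𝟘 ∷ 𝟘 ∷ 𝟙 ∷ 𝟙 ∷ 𝟙 ∷ []) w ∎
      where s = u * u + v * v + w * w

  -- Expansions of (bz + h)⁵ and (bz + h)⁸ modulo h(z³ - z) = 1.

  -- The factor h (z³ - z) - 1 of the last summand vanishes.
  expand-5 : ∀ b z h → (b * z + h) ^ 5 ≡
    b ^ 5 * z ^ 5 - b ^ 4 * (z ^ 2 * h) + b ^ 2 * (z ^ 2 * h ^ 3)
    + z * (b ^ 3 * h ^ 2 - b ^ 4 - b * h ^ 4) + (b ^ 3 * h + h ^ 5)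
    + (h * (z * (z * z) - z) - 1#) * (b ^ 3 * h - b ^ 4 * z)
  expand-5 = solve 3 (λ b z h → (b :* z :+ h) :^^ 5 :=
    b :^^ 5 :* z :^^ 5 :- b :^^ 4 :* (z :^^ 2 :* h) :+ b :^^ 2 :* (z :^^ 2 :* h :^^ 3)
    :+ z :* (b :^^ 3 :* h :^^ 2 :- b :^^ 4 :- b :* h :^^ 4) :+ (b :^^ 3 :* h :+ h :^^ 5)
    :+ (h :* (z :* (z :* z) :- z) :- con 𝟙) :* (b :^^ 3 :* h :- b :^^ 4 :* z)) refl

  -- The coefficient of b⁶ comes from z⁶h² = (z³h)², which uses z³h = zh + 1 twice; hence the
  -- vanishing factor recurs inside its own cofactor.
  expand-8 : ∀ b z h → (b * z + h) ^ 8 ≡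
    b ^ 8 * z ^ 8 - b ^ 7 * z ^ 2 - b ^ 7 * z ^ 4 + (b ^ 6 - b ^ 5) * (z ^ 2 * h ^ 2) + b ^ 4 * (z ^ 2 * h ^ 4) + b ^ 2 * (z ^ 2 * h ^ 6)
    + z * (b ^ 4 * h ^ 3 - b ^ 7 * h - b ^ 6 * h - b ^ 5 * h ^ 3 - b ^ 3 * h ^ 5 - b * h ^ 7)
    + (b ^ 6 - b ^ 7 - b ^ 5 * h ^ 2 - b ^ 3 * h ^ 4 + h ^ 8)
    + (h * (z * (z * z) - z) - 1#)
      * (b ^ 6 * ((h * (z * (z * z) - z) - 1#) - h * z - 1#) - b ^ 7 * (z ^ 4 + z ^ 2 + 1#)
         - b ^ 5 * (z ^ 2 * h ^ 2 + h ^ 2) + b ^ 4 * (z * h ^ 3) - b ^ 3 * h ^ 4)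
  expand-8 = solve 3 (λ b z h → (b :* z :+ h) :^^ 8 :=
    b :^^ 8 :* z :^^ 8 :- b :^^ 7 :* z :^^ 2 :- b :^^ 7 :* z :^^ 4 :+ (b :^^ 6 :- b :^^ 5) :* (z :^^ 2 :* h :^^ 2) :+ b :^^ 4 :* (z :^^ 2 :* h :^^ 4) :+ b :^^ 2 :* (z :^^ 2 :* h :^^ 6)
    :+ z :* (b :^^ 4 :* h :^^ 3 :- b :^^ 7 :* h :- b :^^ 6 :* h :- b :^^ 5 :* h :^^ 3 :- b :^^ 3 :* h :^^ 5 :- b :* h :^^ 7)
    :+ (b :^^ 6 :- b :^^ 7 :- b :^^ 5 :* h :^^ 2 :- b :^^ 3 :* h :^^ 4 :+ h :^^ 8)
    :+ (h :* (z :* (z :* z) :- z) :- con 𝟙)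
      :* (b :^^ 6 :* ((h :* (z :* (z :* z) :- z) :- con 𝟙) :- h :* z :- con 𝟙) :- b :^^ 7 :* (z :^^ 4 :+ z :^^ 2 :+ con 𝟙)
          :- b :^^ 5 :* (z :^^ 2 :* h :^^ 2 :+ h :^^ 2) :+ b :^^ 4 :* (z :* h :^^ 3) :- b :^^ 3 :* h :^^ 4)) refl

-- The field with q³ elements and the map x ↦ x^q.

module CubicExtension {c} (K : Field c) (n : ℕ) (3≤n : 3 ℕ.≤ n) (card : HasCardinality K (3 ℕ.^ (3 ℕ.* n))) where

  open FieldProperties K
  open FiniteField K card

  3≡0 : 1# + 1# + 1# ≡ 0#
  3≡0 = trans (+-assoc 1# 1# 1#) (trans (cong (λ t → 1# + (1# + t)) (sym (+-identityʳ 1#))) (characteristic 3 (3 ℕ.* n) refl))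

  open Characteristic3 K 3≡0

  q : ℕ
  q = 3 ℕ.^ n

  27≤q : 27 ℕ.≤ q
  27≤q = ℕ.^-monoʳ-≤ 3 3≤n

  -- This is q - 1, the order of the unit group of F_q, and not the characteristic.
  p : ℕ
  p = ℕ.pred q

  q≡1+p : q ≡ suc p
  q≡1+p = sym (ℕ.suc-pred q {{ℕ.>-nonZero (ℕ.≤-trans (ℕ.s≤s ℕ.z≤n) 27≤q)}})

  26≤p : 26 ℕ.≤ p
  26≤p = ℕ.≤-pred (subst (27 ℕ.≤_) q≡1+p 27≤q)

  q³≡3^3n : q ℕ.* (q ℕ.* q) ≡ 3 ℕ.^ (3 ℕ.* n)
  q³≡3^3n = sym (begin
    3 ℕ.^ (n ℕ.+ (n ℕ.+ (n ℕ.+ 0)))  ≡⟨ cong (λ k → 3 ℕ.^ (n ℕ.+ (n ℕ.+ k))) (ℕ.+-identityʳ n) ⟩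
    3 ℕ.^ (n ℕ.+ (n ℕ.+ n))          ≡⟨ ℕ.^-distribˡ-+-* 3 n (n ℕ.+ n) ⟩
    q ℕ.* 3 ℕ.^ (n ℕ.+ n)            ≡⟨ cong (q ℕ.*_) (ℕ.^-distribˡ-+-* 3 n n) ⟩
    q ℕ.* (q ℕ.* q)                  ∎)

  x^q³≡x : ∀ x → x ^ (q ℕ.* (q ℕ.* q)) ≡ x
  x^q³≡x x = trans (cong (x ^_) q³≡3^3n) (x^N≡x x)

  φ : Carrier → Carrier
  φ x = x ^ q

  φ≡x*x^p : ∀ x → φ x ≡ x * x ^ p
  φ≡x*x^p x = cong (x ^_) q≡1+p

  φ³≡id : ∀ x → φ (φ (φ x)) ≡ x
  φ³≡id x = begin
    ((x ^ q) ^ q) ^ q        ≡⟨ cong φ (^-* x q q) ⟨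
    (x ^ (q ℕ.* q)) ^ q      ≡⟨ ^-* x q (q ℕ.* q) ⟨
    x ^ (q ℕ.* (q ℕ.* q))    ≡⟨ x^q³≡x x ⟩
    x                        ∎

  φ-+ : ∀ x y → φ (x + y) ≡ φ x + φ y
  φ-+ = frobenius-+ n

  φ-* : ∀ x y → φ (x * y) ≡ φ x * φ y
  φ-* x y = *-^ x y q

  φ-0 : φ 0# ≡ 0#
  φ-0 = trans (φ≡x*x^p 0#) (zeroˡ _)

  φ-1 : φ 1# ≡ 1#
  φ-1 = 1^n≡1 q

  φ-neg : ∀ x → φ (- x) ≡ - φ x
  φ-neg x = +-cancelˡ (φ x) _ _ (begin
    φ x + φ (- x) ≡⟨ φ-+ x (- x) ⟨
    φ (x - x)     ≡⟨ cong φ (-‿inverseʳ x) ⟩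
    φ 0#          ≡⟨ φ-0 ⟩
    0#            ≡⟨ -‿inverseʳ (φ x) ⟨
    φ x - φ x     ∎)

  φ-- : ∀ x y → φ (x - y) ≡ φ x - φ y
  φ-- x y = trans (φ-+ x (- y)) (cong (φ x +_) (φ-neg y))

  φ-⁻¹ : ∀ x → φ (x ⁻¹) ≡ (φ x) ⁻¹
  φ-⁻¹ x with x ≟ 0#
  ... | yes refl = trans (cong φ ⁻¹-zero) (trans φ-0 (trans (sym ⁻¹-zero) (cong _⁻¹ (sym φ-0))))
  ... | no  x≢0  = ⁻¹-unique (trans (sym (φ-* x (x ⁻¹))) (trans (cong φ (⁻¹-inverse x x≢0)) φ-1))

  Fixed : Carrier → Set c
  Fixed x = φ x ≡ x

  Fixed? : ∀ x → Dec (Fixed x)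
  Fixed? x = φ x ≟ x

  module _ {x y} (x∈ : Fixed x) (y∈ : Fixed y) where
    fixed-+ : Fixed (x + y)
    fixed-+ = trans (φ-+ x y) (cong₂ _+_ x∈ y∈)

    fixed-- : Fixed (x - y)
    fixed-- = trans (φ-- x y) (cong₂ _-_ x∈ y∈)

    fixed-* : Fixed (x * y)
    fixed-* = trans (φ-* x y) (cong₂ _*_ x∈ y∈)

  fixed-⁻¹ : ∀ {x} → Fixed x → Fixed (x ⁻¹)
  fixed-⁻¹ {x} x∈ = trans (φ-⁻¹ x) (cong _⁻¹ x∈)

  fixed-neg : ∀ {x} → Fixed x → Fixed (- x)
  fixed-neg {x} x∈ = trans (φ-neg x) (cong -_ x∈)

  fixed-^ : ∀ {x} k → Fixed x → Fixed (x ^ k)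
  fixed-^ zero    x∈ = φ-1
  fixed-^ (suc k) x∈ = fixed-* x∈ (fixed-^ k x∈)

  -- F_q as a list of fixed points, and a lower bound for its size.

  Fq : List Carrier
  Fq = filter Fixed? elements

  Fq-unique : Unique Fq
  Fq-unique = filter⁺ Fixed? elements-unique

  fixed⇒∈ : ∀ {x} → Fixed x → x ∈ Fq
  fixed⇒∈ = ∈-filter⁺ Fixed? (∈-elements _)

  ∈⇒fixed : ∀ {x} → x ∈ Fq → Fixed x
  ∈⇒fixed x∈ = proj₂ (∈-filter⁻ Fixed? {xs = elements} x∈)

  length-filter-split : ∀ {a ℓ} {A : Set a} {P : Pred A ℓ} (P? : Decidable P) xs →
    length (filter P? xs) ℕ.+ length (filter (λ x → ¬? (P? x)) xs) ≡ length xs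
  length-filter-split P? []       = refl
  length-filter-split P? (x ∷ xs) with P? x
  ... | yes _ = cong suc (length-filter-split P? xs)
  ... | no  _ = trans (ℕ.+-suc _ _) (cong suc (length-filter-split P? xs))

  -- Elements outside F_q are roots of (X^(q³-1) - 1)/(X^(q-1) - 1), so there are at most q³ - q of them.
  q≤length-Fq : q ℕ.≤ length Fq
  q≤length-Fq = ℕ.+-cancelʳ-≤ (d ℕ.* p) q (length Fq) (ℕ.≤-trans
    (ℕ.≤-reflexive (trans (sym total) (sym (length-filter-split Fixed? elements))))
    (ℕ.+-monoʳ-≤ (length Fq) (subst (λ k → length (filter (λ x → ¬? (Fixed? x)) elements) ℕ.≤ d ℕ.* k) p≡1+p′
      (Monic-roots≤degree (monic-geometric (ℕ.pred p) d) (filter⁺ _ elements-unique)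
        (All.map (λ {x} x∉ → subst (λ k → geometric (x ^ k) d ≡ 0#) (sym p≡1+p′) (root x∉)) (all-filter _ elements))))))
    where
    d : ℕ
    d = q ℕ.* q ℕ.+ q

    p≡1+p′ : suc (ℕ.pred p) ≡ p
    p≡1+p′ = ℕ.suc-pred p {{ℕ.>-nonZero (ℕ.≤-trans (ℕ.s≤s ℕ.z≤n) 26≤p)}}

    q³ : q ℕ.* (q ℕ.* q) ≡ suc (suc d ℕ.* p)
    q³ rewrite q≡1+p = suc-cubed p

    total : length elements ≡ q ℕ.+ d ℕ.* p
    total = trans length-elements (trans (sym q³≡3^3n) (trans q³ (cong (ℕ._+ d ℕ.* p) (sym q≡1+p))))

    root : ∀ {x} → ¬ Fixed x → geometric (x ^ p) d ≡ 0#
    root {x} x∉ = xy≡0∧x≢0⇒y≡0 (begin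
      (φ x - x) * geometric (x ^ p) d            ≡⟨ cong (λ t → (t - x) * geometric (x ^ p) d) (φ≡x*x^p x) ⟩
      (x * x ^ p - x) * geometric (x ^ p) d
        ≡⟨ solve 3 (λ x t g → (x :* t :- x) :* g := x :* ((t :- con 𝟙) :* g)) refl x _ _ ⟩
      x * ((x ^ p - 1#) * geometric (x ^ p) d)   ≡⟨ cong (x *_) (geometric-sum (x ^ p) d) ⟩
      x * ((x ^ p) ^ suc d - 1#)                 ≡⟨ cong (λ t → x * (t - 1#)) (^-* x (suc d) p) ⟨
      x * (x ^ (suc d ℕ.* p) - 1#)               ≡⟨ solve 2 (λ x t → x :* (t :- con 𝟙) := x :* t :- x) refl x _ ⟩
      x ^ suc (suc d ℕ.* p) - x                  ≡⟨ cong (λ k → x ^ k - x) q³ ⟨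
      x ^ (q ℕ.* (q ℕ.* q)) - x                  ≡⟨ x≡y⇒x-y≡0 (x^q³≡x x) ⟩
      0#                                         ∎)
      (λ eq → x∉ (x-y≡0⇒x≡y eq))

  -- Power sums over F_q.

  ∑Fq : (Carrier → Carrier) → Carrier
  ∑Fq = ∑ Fq

  ∑Fq-cong : ∀ {g h} → (∀ {x} → Fixed x → g x ≡ h x) → ∑Fq g ≡ ∑Fq h
  ∑Fq-cong eq = ∑-cong Fq (λ x∈ → eq (∈⇒fixed x∈))

  ∑Fq-bijection : (σ τ g : Carrier → Carrier) →
    (∀ {x} → Fixed x → Fixed (σ x)) → (∀ {x} → Fixed x → Fixed (τ x)) →
    (∀ {x} → Fixed x → τ (σ x) ≡ x) → (∀ {x} → Fixed x → σ (τ x) ≡ x) →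
    ∑Fq (λ x → g (σ x)) ≡ ∑Fq g
  ∑Fq-bijection σ τ g σ∈ τ∈ τσ στ = ∑-permute σ g (bijection⇒map-↭ Fq-unique σ τ
    (λ x∈ → fixed⇒∈ (σ∈ (∈⇒fixed x∈))) (λ x∈ → fixed⇒∈ (τ∈ (∈⇒fixed x∈)))
    (λ x∈ → τσ (∈⇒fixed x∈)) (λ x∈ → στ (∈⇒fixed x∈)))

  ∑Fq-translate : ∀ {t} g → Fixed t → ∑Fq (λ x → g (x + t)) ≡ ∑Fq g
  ∑Fq-translate {t} g t∈ = ∑Fq-bijection (_+ t) (_- t) g
    (λ x∈ → fixed-+ x∈ t∈) (λ x∈ → fixed-- x∈ t∈)
    (λ {x} _ → solve 2 (λ x t → x :+ t :- t := x) refl x t)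
    (λ {x} _ → solve 2 (λ x t → x :- t :+ t := x) refl x t)

  ∑Fq-scale : ∀ {t} g → Fixed t → t ≢ 0# → ∑Fq (λ x → g (t * x)) ≡ ∑Fq g
  ∑Fq-scale {t} g t∈ t≢0 = ∑Fq-bijection (t *_) (t ⁻¹ *_) g
    (fixed-* t∈) (fixed-* (fixed-⁻¹ t∈))
    (λ {x} _ → x⁻¹*[x*y]≡y t≢0 x) (λ {x} _ → x*[x⁻¹*y]≡y t≢0 x)

  -- X^(i+2) - X is monic of degree i + 2 ≤ p < q, so it cannot vanish on all of F_q; a point where
  -- it does not vanish is nonzero and not a root of unity of order dividing i + 1. It is written in
  -- Horner form to match `monic-step`.
  ∃-non-root-of-unity : ∀ i → suc i ℕ.< p → ∃[ t ] (Fixed t × t ≢ 0# × t ^ suc i ≢ 1#)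
  ∃-non-root-of-unity i 1+i<p with all? (λ x → (0# + x * (- 1# + x * (x ^ i * 1#))) ≟ 0#) Fq
  ... | yes all = contradiction
        (ℕ.≤-trans q≤length-Fq (Monic-roots≤degree (monic-step 0# (monic-step (- 1#) (monic-^* i monic-1))) Fq-unique all))
        (ℕ.<⇒≱ (subst₂ ℕ._<_ (cong (λ k → suc (suc k)) (sym (ℕ.+-identityʳ i))) (sym q≡1+p) (ℕ.s≤s 1+i<p)))
  ... | no ¬all with find (¬All⇒Any¬ (λ x → (0# + x * (- 1# + x * (x ^ i * 1#))) ≟ 0#) Fq ¬all)
  ...   | t , t∈ , t-bad = t , ∈⇒fixed t∈
        , (λ { refl → t-bad (trans (cong (0# +_) (zeroˡ _)) (+-identityˡ 0#)) })
        , λ t^≡1 → t-bad (begin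
            0# + t * (- 1# + t * (t ^ i * 1#))
              ≡⟨ solve 2 (λ t s → con 𝟘 :+ t :* (:- con 𝟙 :+ t :* (s :* con 𝟙))
                   := t :* (t :* s :- con 𝟙)) refl t (t ^ i) ⟩
            t * (t ^ suc i - 1#)               ≡⟨ cong (t *_) (x≡y⇒x-y≡0 t^≡1) ⟩
            t * 0#                             ≡⟨ zeroʳ t ⟩
            0#                                 ∎)

  ∑Fq-1 : ∑Fq (λ _ → 1#) ≡ 0#
  ∑Fq-1 = ∑1≡0 Fq Fq-unique
    (λ x∈ → fixed⇒∈ (fixed-+ (∈⇒fixed x∈) φ-1)) (λ x∈ → fixed⇒∈ (fixed-- (∈⇒fixed x∈) φ-1))

  -- The substitution x ↦ tx multiplies the sum by t^i without changing it, and t is chosen with t^i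
  -- ≠ 1. The exponent 0 is separate: there the sum counts F_q modulo 3.
  ∑Fq-^ : ∀ i → i ℕ.< p → ∑Fq (_^ i) ≡ 0#
  ∑Fq-^ zero    _ = ∑Fq-1
  ∑Fq-^ (suc i) 1+i<p with ∃-non-root-of-unity i 1+i<p
  ... | t , t∈ , t≢0 , t^≢1 = xy≡0∧x≢0⇒y≡0 (begin
    (t ^ suc i - 1#) * S      ≡⟨ solve 2 (λ k S → (k :- con 𝟙) :* S := k :* S :- S) refl (t ^ suc i) S ⟩
    t ^ suc i * S - S         ≡⟨ x≡y⇒x-y≡0 (begin
      t ^ suc i * S                         ≡⟨ ∑-* Fq (t ^ suc i) (_^ suc i) ⟨
      ∑Fq (λ x → t ^ suc i * x ^ suc i)     ≡⟨ ∑Fq-cong (λ {x} _ → *-^ t x (suc i)) ⟨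
      ∑Fq (λ x → (t * x) ^ suc i)           ≡⟨ ∑Fq-scale (_^ suc i) t∈ t≢0 ⟩
      S                                     ∎) ⟩
    0#                        ∎)
    (λ eq → t^≢1 (x-y≡0⇒x≡y eq))
    where
    S = ∑Fq (_^ suc i)

  ∑Fq-linear : ∀ k l g h → ∑Fq (λ x → k * g x + l * h x) ≡ k * ∑Fq g + l * ∑Fq h
  ∑Fq-linear k l g h = trans (∑-+ Fq _ _) (cong₂ _+_ (∑-* Fq k g) (∑-* Fq l h))

  -- On F_q the function 1 - x^p is the indicator of 0, so its sum is 1, while Σ 1 = 0.
  ∑Fq-^p : ∑Fq (_^ p) ≡ - 1#
  ∑Fq-^p = begin
    S                                      ≡⟨ solve 1 (λ S → S := :- (con 𝟙 :* con 𝟘 :+ (:- con 𝟙) :* S)) refl S ⟩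
    - (1# * 0# + (- 1#) * S)               ≡⟨ cong (λ t → - (1# * t + (- 1#) * S)) ∑Fq-1 ⟨
    - (1# * ∑Fq (λ _ → 1#) + (- 1#) * S)   ≡⟨ cong -_ (∑Fq-linear 1# (- 1#) (λ _ → 1#) (_^ p)) ⟨
    - ∑Fq (λ x → δ (x ^ p))                ≡⟨ cong -_ (∑-cong Fq (λ x∈ → sym (extend (∈⇒fixed x∈)))) ⟩
    - ∑Fq δ₀                               ≡⟨ cong -_ (∑-delta δ₀ (fixed⇒∈ φ-0) Fq-unique δ₀-off) ⟩
    - δ₀ 0#                                ≡⟨ cong -_ δ₀-at ⟩
    - 1#                                   ∎
    where
    S = ∑Fq (_^ p)
    δ : Carrier → Carrier
    δ t = 1# * 1# + (- 1#) * t
    δ₀ : Carrier → Carrier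
    δ₀ x with x ≟ 0#
    ... | yes _ = 1#
    ... | no  _ = 0#
    δ₀-off : ∀ {x} → x ≢ 0# → δ₀ x ≡ 0#
    δ₀-off {x} x≢0 with x ≟ 0#
    ... | yes x≡0 = contradiction x≡0 x≢0
    ... | no  _   = refl
    δ₀-at : δ₀ 0# ≡ 1#
    δ₀-at with 0# ≟ 0#
    ... | yes _   = refl
    ... | no  0≢0 = contradiction refl 0≢0
    0^p≡0 : 0# ^ p ≡ 0#
    0^p≡0 with p | 26≤p
    ... | suc _ | _ = zeroˡ _
    extend : ∀ {x} → Fixed x → δ₀ x ≡ δ (x ^ p)
    extend {x} x∈ with x ≟ 0#
    ... | yes refl = sym (trans (cong δ 0^p≡0) (solve 0 (con 𝟙 :* con 𝟙 :+ (:- con 𝟙) :* con 𝟘 := con 𝟙) refl))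
    ... | no  x≢0  = sym (trans (cong δ (*-cancel-nonzeroˡ x≢0 (trans (sym (φ≡x*x^p x)) (trans x∈ (sym (*-identityʳ x))))))
                       (solve 0 (con 𝟙 :* con 𝟙 :+ (:- con 𝟙) :* con 𝟙 := con 𝟘) refl))

  ∑Fq-shift-step : ∀ r m i → ∑Fq (λ x → x ^ m * (x - r) ^ suc i)
    ≡ 1# * ∑Fq (λ x → x ^ suc m * (x - r) ^ i) + (- r) * ∑Fq (λ x → x ^ m * (x - r) ^ i)
  ∑Fq-shift-step r m i = trans
    (∑Fq-cong λ {x} _ → solve 4 (λ x r s t → s :* ((x :- r) :* t) := con 𝟙 :* (x :* s :* t) :+ (:- r) :* (s :* t))
      refl x r (x ^ m) ((x - r) ^ i))
    (∑Fq-linear 1# (- r) _ _)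

  -- The factor x^m allows one x - r to be multiplied out at a time. The total degree never grows,
  -- and binomial coefficients never appear.
  ∑Fq-monomial-shift : ∀ r m i → m ℕ.+ i ℕ.< p → ∑Fq (λ x → x ^ m * (x - r) ^ i) ≡ 0#
  ∑Fq-monomial-shift r m zero    m<p = trans (∑Fq-cong (λ _ → *-identityʳ _))
    (∑Fq-^ m (subst (ℕ._< p) (ℕ.+-identityʳ m) m<p))
  ∑Fq-monomial-shift r m (suc i) m+1+i<p = begin
    _                    ≡⟨ ∑Fq-shift-step r m i ⟩
    _                    ≡⟨ cong₂ (λ s t → 1# * s + (- r) * t)
                              (∑Fq-monomial-shift r (suc m) i 1+m+i<p)
                              (∑Fq-monomial-shift r m i (ℕ.<-trans (ℕ.n<1+n _) 1+m+i<p)) ⟩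
    1# * 0# + (- r) * 0# ≡⟨ solve 1 (λ r → con 𝟙 :* con 𝟘 :+ (:- r) :* con 𝟘 := con 𝟘) refl r ⟩
    0#                   ∎
    where
    1+m+i<p = subst (ℕ._< p) (ℕ.+-suc m i) m+1+i<p

  -- Only the leading term x^p contributes; every branch multiplied by -r drops below degree p and
  -- sums to 0.
  ∑Fq-monomial-shift-p : ∀ r m i → m ℕ.+ i ≡ p → ∑Fq (λ x → x ^ m * (x - r) ^ i) ≡ - 1#
  ∑Fq-monomial-shift-p r m zero    m≡p = trans (∑Fq-cong (λ _ → *-identityʳ _))
    (trans (cong (λ k → ∑Fq (_^ k)) (trans (sym (ℕ.+-identityʳ m)) m≡p)) ∑Fq-^p)
  ∑Fq-monomial-shift-p r m (suc i) m+1+i≡p = begin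
    _                         ≡⟨ ∑Fq-shift-step r m i ⟩
    _                         ≡⟨ cong₂ (λ s t → 1# * s + (- r) * t)
                                   (∑Fq-monomial-shift-p r (suc m) i 1+m+i≡p)
                                   (∑Fq-monomial-shift r m i (ℕ.≤-reflexive 1+m+i≡p)) ⟩
    1# * (- 1#) + (- r) * 0#  ≡⟨ solve 1 (λ r → con 𝟙 :* (:- con 𝟙) :+ (:- r) :* con 𝟘 := :- con 𝟙) refl r ⟩
    - 1#                      ∎
    where
    1+m+i≡p = trans (sym (ℕ.+-suc m i)) m+1+i≡p

  ∑Fq-shift : ∀ r i → i ℕ.< p → ∑Fq (λ x → (x - r) ^ i) ≡ 0#
  ∑Fq-shift r i i<p = trans (∑Fq-cong (λ _ → sym (*-identityˡ _))) (∑Fq-monomial-shift r 0 i i<p)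

  ∑Fq-shift-p : ∀ r → ∑Fq (λ x → (x - r) ^ p) ≡ - 1#
  ∑Fq-shift-p r = trans (∑Fq-cong (λ _ → sym (*-identityˡ _))) (∑Fq-monomial-shift-p r 0 p refl)

  -- Sums of reciprocal powers over F_q.

  fixed-≢ : ∀ {x r} → Fixed x → ¬ Fixed r → x - r ≢ 0#
  fixed-≢ x∈ r∉ x-r≡0 = r∉ (subst Fixed (x-y≡0⇒x≡y x-r≡0) x∈)

  module _ {r} (r∉ : ¬ Fixed r) where

    -- For x ∈ F_q:  (x - r)(x - r)^p = (x - r)^q = x - r^q.
    [r-φr]/[x-r] : ∀ {x} → Fixed x → (r - φ r) * (x - r) ⁻¹ ≡ (x - r) ^ p - 1#
    [r-φr]/[x-r] {x} x∈ = *-cancel-nonzeroˡ x-r≢0 (begin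
      (x - r) * ((r - φ r) * (x - r) ⁻¹)
        ≡⟨ solve 3 (λ z D u → z :* (D :* u) := D :* (z :* u)) refl (x - r) (r - φ r) _ ⟩
      (r - φ r) * ((x - r) * (x - r) ⁻¹)  ≡⟨ cong ((r - φ r) *_) (⁻¹-inverse _ x-r≢0) ⟩
      (r - φ r) * 1#
        ≡⟨ solve 3 (λ x r s → (r :- s) :* con 𝟙 := (x :- s) :- (x :- r)) refl x r (φ r) ⟩
      (x - φ r) - (x - r)                 ≡⟨ cong (λ t → (t - φ r) - (x - r)) x∈ ⟨
      (φ x - φ r) - (x - r)               ≡⟨ cong (_- (x - r)) (φ-- x r) ⟨
      φ (x - r) - (x - r)                 ≡⟨ cong (_- (x - r)) (φ≡x*x^p (x - r)) ⟩
      (x - r) * (x - r) ^ p - (x - r)     ≡⟨ solve 2 (λ z t → z :* t :- z := z :* (t :- con 𝟙)) refl (x - r) _ ⟩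
      (x - r) * ((x - r) ^ p - 1#)        ∎)
      where x-r≢0 = fixed-≢ x∈ r∉

    ∑Fq-inverse : (φ r - r) * ∑Fq (λ x → (x - r) ⁻¹) ≡ 1#
    ∑Fq-inverse = begin
      (φ r - r) * S
        ≡⟨ solve 3 (λ s r S → (s :- r) :* S := :- ((r :- s) :* S)) refl (φ r) r S ⟩
      - ((r - φ r) * S)                        ≡⟨ cong -_ (∑-* Fq (r - φ r) _) ⟨
      - ∑Fq (λ x → (r - φ r) * (x - r) ⁻¹)     ≡⟨ cong -_ (∑Fq-cong λ {x} x∈ → trans ([r-φr]/[x-r] x∈)
                                                    (solve 1 (λ t → t :- con 𝟙
                                                         := con 𝟙 :* t :+ (:- con 𝟙) :* con 𝟙) refl ((x - r) ^ p))) ⟩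
      - ∑Fq (λ x → 1# * (x - r) ^ p + (- 1#) * 1#) ≡⟨ cong -_ (∑Fq-linear 1# (- 1#) _ _) ⟩
      - (1# * ∑Fq (λ x → (x - r) ^ p) + (- 1#) * ∑Fq (λ _ → 1#))
                                               ≡⟨ cong₂ (λ s t → - (1# * s + (- 1#) * t)) (∑Fq-shift-p r) ∑Fq-1 ⟩
      - (1# * (- 1#) + (- 1#) * 0#)
        ≡⟨ solve 0 (:- (con 𝟙 :* (:- con 𝟙) :+ (:- con 𝟙) :* con 𝟘) := con 𝟙) refl ⟩
      1#                                       ∎
      where S = ∑Fq (λ x → (x - r) ⁻¹)

    [x-r]⁻¹^j*[x-r]^p : ∀ {x} → Fixed x → ∀ j → j ℕ.≤ p → ((x - r) ⁻¹) ^ j * (x - r) ^ p ≡ (x - r) ^ (p ℕ.∸ j)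
    [x-r]⁻¹^j*[x-r]^p {x} x∈ j j≤p = begin
      ((x - r) ⁻¹) ^ j * (x - r) ^ p
        ≡⟨ cong (λ k → ((x - r) ⁻¹) ^ j * (x - r) ^ k) (ℕ.m+[n∸m]≡n j≤p) ⟨
      ((x - r) ⁻¹) ^ j * (x - r) ^ (j ℕ.+ (p ℕ.∸ j))
        ≡⟨ cong (((x - r) ⁻¹) ^ j *_) (^-+ (x - r) j (p ℕ.∸ j)) ⟩
      ((x - r) ⁻¹) ^ j * ((x - r) ^ j * (x - r) ^ (p ℕ.∸ j))  ≡⟨ *-assoc _ _ _ ⟨
      ((x - r) ⁻¹) ^ j * (x - r) ^ j * (x - r) ^ (p ℕ.∸ j)    ≡⟨ cong (_* (x - r) ^ (p ℕ.∸ j)) (*-^ _ _ j) ⟨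
      ((x - r) ⁻¹ * (x - r)) ^ j * (x - r) ^ (p ℕ.∸ j)
        ≡⟨ cong (λ t → t ^ j * (x - r) ^ (p ℕ.∸ j)) (trans (*-comm _ _) (⁻¹-inverse _ (fixed-≢ x∈ r∉))) ⟩
      1# ^ j * (x - r) ^ (p ℕ.∸ j)                            ≡⟨ cong (_* (x - r) ^ (p ℕ.∸ j)) (1^n≡1 j) ⟩
      1# * (x - r) ^ (p ℕ.∸ j)                                ≡⟨ *-identityˡ _ ⟩
      (x - r) ^ (p ℕ.∸ j)                                     ∎

    -- The formula for 1/(x - r), multiplied by (x - r)^-(j+1), leaves the previous reciprocal power
    -- and a nonnegative power of exponent below p, whose sum vanishes.
    ∑Fq-inverse-power-step : ∀ j → suc j ℕ.≤ p →
      (φ r - r) * ∑Fq (λ x → ((x - r) ⁻¹) ^ suc (suc j)) ≡ ∑Fq (λ x → ((x - r) ⁻¹) ^ suc j)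
    ∑Fq-inverse-power-step j 1+j≤p = begin
      (φ r - r) * ∑Fq (λ x → ((x - r) ⁻¹) ^ suc (suc j))      ≡⟨ ∑-* Fq (φ r - r) _ ⟨
      ∑Fq (λ x → (φ r - r) * ((x - r) ⁻¹) ^ suc (suc j))      ≡⟨ ∑Fq-cong (λ x∈ → expand x∈) ⟩
      ∑Fq (λ x → 1# * ((x - r) ⁻¹) ^ suc j + (- 1#) * (x - r) ^ (p ℕ.∸ suc j))
                                                              ≡⟨ ∑Fq-linear 1# (- 1#) _ _ ⟩
      1# * S + (- 1#) * ∑Fq (λ x → (x - r) ^ (p ℕ.∸ suc j))
        ≡⟨ cong (λ t → 1# * S + (- 1#) * t) (∑Fq-shift r (p ℕ.∸ suc j) (ℕ.∸-monoʳ-< {p} (ℕ.s≤s ℕ.z≤n) 1+j≤p)) ⟩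
      1# * S + (- 1#) * 0#
        ≡⟨ solve 1 (λ S → con 𝟙 :* S :+ (:- con 𝟙) :* con 𝟘 := S) refl S ⟩
      S                                                       ∎
      where
      S = ∑Fq (λ x → ((x - r) ⁻¹) ^ suc j)
      expand : ∀ {x} → Fixed x → (φ r - r) * ((x - r) ⁻¹) ^ suc (suc j)
        ≡ 1# * ((x - r) ⁻¹) ^ suc j + (- 1#) * (x - r) ^ (p ℕ.∸ suc j)
      expand {x} x∈ = begin
        (φ r - r) * (u * u ^ suc j)
          ≡⟨ solve 4 (λ s r u v → (s :- r) :* (u :* v) := :- ((r :- s) :* u) :* v) refl (φ r) r u (u ^ suc j) ⟩
        - ((r - φ r) * u) * u ^ suc j             ≡⟨ cong (λ t → - t * u ^ suc j) ([r-φr]/[x-r] x∈) ⟩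
        - ((x - r) ^ p - 1#) * u ^ suc j
          ≡⟨ solve 2 (λ t v → :- (t :- con 𝟙) :* v
               := con 𝟙 :* v :+ (:- con 𝟙) :* (v :* t)) refl ((x - r) ^ p) (u ^ suc j) ⟩
        1# * u ^ suc j + (- 1#) * (u ^ suc j * (x - r) ^ p)
          ≡⟨ cong (λ t → 1# * u ^ suc j + (- 1#) * t) ([x-r]⁻¹^j*[x-r]^p x∈ (suc j) 1+j≤p) ⟩
        1# * u ^ suc j + (- 1#) * (x - r) ^ (p ℕ.∸ suc j) ∎
        where u = (x - r) ⁻¹

    -- With r^q - r = 1 every step of the recursion has factor 1, so all exponents give the same
    -- sum.
    ∑Fq-inverse-power : φ r ≡ r + 1# → ∀ j → j ℕ.≤ p → ∑Fq (λ x → ((x - r) ⁻¹) ^ suc j) ≡ 1#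
    ∑Fq-inverse-power φr≡r+1 = go
      where
      unit : ∀ S → (φ r - r) * S ≡ S
      unit S = trans (cong (λ t → (t - r) * S) φr≡r+1)
        (solve 2 (λ r S → (r :+ con 𝟙 :- r) :* S := S) refl r S)
      go : ∀ j → j ℕ.≤ p → ∑Fq (λ x → ((x - r) ⁻¹) ^ suc j) ≡ 1#
      go zero    _     = trans (∑Fq-cong (λ _ → *-identityʳ _)) (trans (sym (unit _)) ∑Fq-inverse)
      go (suc j) 1+j≤p = trans (sym (unit _))
        (trans (∑Fq-inverse-power-step j 1+j≤p) (go j (ℕ.<⇒≤ 1+j≤p)))

  -- A coefficient, a function, and the value claimed for the sum of that function over F_q.
  Term : Set c
  Term = Carrier × (Carrier → Carrier) × Carrier

  combination : List Term → Carrier → Carrier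
  combination []                 x = 0#
  combination ((k , g , _) ∷ ts) x = k * g x + combination ts x

  combination-sum : List Term → Carrier
  combination-sum []                 = 0#
  combination-sum ((k , _ , s) ∷ ts) = k * s + combination-sum ts

  ∑Fq-combination : ∀ ts → All (λ (_ , g , s) → ∑Fq g ≡ s) ts → ∑Fq (combination ts) ≡ combination-sum ts
  ∑Fq-combination []                 []           = ∑-zero Fq
  ∑Fq-combination ((k , g , s) ∷ ts) (eq ∷ eqs) = begin
    ∑Fq (λ x → k * g x + combination ts x)  ≡⟨ ∑-+ Fq _ _ ⟩
    ∑Fq (λ x → k * g x) + ∑Fq (combination ts)
      ≡⟨ cong₂ _+_ (trans (∑-* Fq k g) (cong (k *_) eq)) (∑Fq-combination ts eqs) ⟩
    k * s + combination-sum ts              ∎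

  -- The normalised map, with poles ρ, ρ + 1 and ρ - 1.

  module Normalised {ρ : Carrier} (φρ≡ρ+1 : φ ρ ≡ ρ + 1#) where

    ρ+1 ρ-1 : Carrier
    ρ+1 = ρ + 1#
    ρ-1 = ρ - 1#

    not-fixed : ∀ {r} → φ r ≡ r + 1# → ¬ Fixed r
    not-fixed {r} φr≡r+1 φr≡r = 0≢1 (+-cancelˡ r _ _ (trans (+-identityʳ r) (trans (sym φr≡r) φr≡r+1)))

    φ[ρ+1] : φ ρ+1 ≡ ρ+1 + 1#
    φ[ρ+1] = trans (φ-+ ρ 1#) (cong₂ _+_ φρ≡ρ+1 φ-1)

    φ[ρ-1] : φ ρ-1 ≡ ρ-1 + 1#
    φ[ρ-1] = trans (φ-- ρ 1#) (trans (cong₂ _-_ φρ≡ρ+1 φ-1)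
      (solve 1 (λ r → r :+ con 𝟙 :- con 𝟙 := r :- con 𝟙 :+ con 𝟙) refl ρ))

    z u v w : Carrier → Carrier
    z y = y - ρ
    u y = (y - ρ) ⁻¹
    v y = (y - ρ+1) ⁻¹
    w y = (y - ρ-1) ⁻¹

    module _ {y} (y∈ : Fixed y) where
      zu≡1 : z y * u y ≡ 1#
      zu≡1 = ⁻¹-inverse _ (fixed-≢ y∈ (not-fixed φρ≡ρ+1))

      zv≡1+v : z y * v y ≡ 1# + v y
      zv≡1+v = trans (solve 3 (λ y r v → (y :- r) :* v := (y :- (r :+ con 𝟙)) :* v :+ v) refl y ρ (v y))
        (cong (_+ v y) (⁻¹-inverse _ (fixed-≢ y∈ (not-fixed φ[ρ+1]))))

      zw≡1-w : z y * w y ≡ 1# - w y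
      zw≡1-w = trans (solve 3 (λ y r w → (y :- r) :* w := (y :- (r :- con 𝟙)) :* w :- w) refl y ρ (w y))
        (cong (_- w y) (⁻¹-inverse _ (fixed-≢ y∈ (not-fixed φ[ρ-1]))))

      open PartialFractions zu≡1 zv≡1+v zw≡1-w public hiding (h)

    h : Carrier → Carrier
    h y = - (u y + v y + w y)

    -- Translation by 1 permutes the three poles cyclically.
    h-periodic : ∀ y → h (y + 1#) ≡ h y
    h-periodic y = cong -_ (begin
      (y + 1# - ρ) ⁻¹ + (y + 1# - (ρ + 1#)) ⁻¹ + (y + 1# - (ρ - 1#)) ⁻¹
        ≡⟨ cong₂ _+_ (cong₂ (λ s t → s ⁻¹ + t ⁻¹)
             (solve 2 (λ y r → y :+ con 𝟙 :- r := y :- (r :- con 𝟙)) refl y ρ)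
             (solve 2 (λ y r → y :+ con 𝟙 :- (r :+ con 𝟙) := y :- r) refl y ρ))
             (cong _⁻¹ (solve 2 (λ y r → y :+ con 𝟙 :- (r :- con 𝟙) := y :- (r :+ con 𝟙)) refl y ρ)) ⟩
      w y + u y + v y ≡⟨ solve 3 (λ u v w → w :+ u :+ v := u :+ v :+ w) refl (u y) (v y) (w y) ⟩
      u y + v y + w y ∎)

    -- Translation by 1 turns z F(h) into (z + 1) F(h) without changing its sum, so the difference
    -- F(h) sums to 0.
    ∑Fq-F[h] : ∀ (F : Carrier → Carrier) → ∑Fq (λ y → F (h y)) ≡ 0#
    ∑Fq-F[h] F = +-cancelˡ (∑Fq (λ y → z y * F (h y))) _ _ (begin
      ∑Fq (λ y → z y * F (h y)) + ∑Fq (λ y → F (h y)) ≡⟨ ∑-+ Fq _ _ ⟨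
      ∑Fq (λ y → z y * F (h y) + F (h y))             ≡⟨ ∑Fq-cong (λ {y} _ → trans
          (solve 3 (λ y r f → (y :- r) :* f :+ f := (y :+ con 𝟙 :- r) :* f) refl y ρ (F (h y)))
          (cong (λ t → z (y + 1#) * F t) (sym (h-periodic y)))) ⟩
      ∑Fq (λ y → z (y + 1#) * F (h (y + 1#)))         ≡⟨ ∑Fq-translate (λ y → z y * F (h y)) φ-1 ⟩
      ∑Fq (λ y → z y * F (h y))                       ≡⟨ +-identityʳ _ ⟨
      ∑Fq (λ y → z y * F (h y)) + 0#                  ∎)

    -- The same comparison for z² F(h), where (z + 1)² - z² = 2z + 1. It stops here: (z + 1)³ - z³ =
    -- 1 says nothing about z² F(h), which is why those sums go through partial fractions.
    ∑Fq-zF[h] : ∀ (F : Carrier → Carrier) → ∑Fq (λ y → z y * F (h y)) ≡ 0#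
    ∑Fq-zF[h] F = begin
      S₁            ≡⟨ solve 1 (λ S₁ → S₁ := :- (con 𝟚 :* S₁ :+ con 𝟙 :* con 𝟘)) refl S₁ ⟩
      - ((1# + 1#) * S₁ + 1# * 0#)             ≡⟨ cong (λ t → - ((1# + 1#) * S₁ + 1# * t)) (∑Fq-F[h] F) ⟨
      - ((1# + 1#) * S₁ + 1# * ∑Fq (λ y → F (h y)))    ≡⟨ cong -_ (∑Fq-linear (1# + 1#) 1# _ _) ⟨
      - S₂          ≡⟨ cong -_ (+-cancelˡ (∑Fq (λ y → z y * (z y * F (h y)))) _ _ (begin
        ∑Fq (λ y → z y * (z y * F (h y))) + S₂                             ≡⟨ ∑-+ Fq _ _ ⟨
        ∑Fq (λ y → z y * (z y * F (h y)) + ((1# + 1#) * (z y * F (h y)) + 1# * F (h y))) ≡⟨ ∑Fq-cong (λ {y} _ → trans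
          (solve 3 (λ y r f → (y :- r) :* ((y :- r) :* f) :+ (con 𝟚 :* ((y :- r) :* f) :+ con 𝟙 :* f)
               := (y :+ con 𝟙 :- r) :* ((y :+ con 𝟙 :- r) :* f)) refl y ρ (F (h y)))
          (cong (λ t → z (y + 1#) * (z (y + 1#) * F t)) (sym (h-periodic y)))) ⟩
        ∑Fq (λ y → z (y + 1#) * (z (y + 1#) * F (h (y + 1#))))
          ≡⟨ ∑Fq-translate (λ y → z y * (z y * F (h y))) φ-1 ⟩
        ∑Fq (λ y → z y * (z y * F (h y)))                                  ≡⟨ +-identityʳ _ ⟨
        ∑Fq (λ y → z y * (z y * F (h y))) + 0#                             ∎)) ⟩
      - 0#          ≡⟨ solve 0 (:- con 𝟘 := con 𝟘) refl ⟩
      0#            ∎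
      where
      S₁ = ∑Fq (λ y → z y * F (h y))
      S₂ = ∑Fq (λ y → (1# + 1#) * (z y * F (h y)) + 1# * F (h y))

    5≤p : 5 ℕ.≤ p
    5≤p = ℕ.≤-trans (from-yes (5 ℕ.≤? 26)) 26≤p

    ∑z^ : ∀ j {j≤8 : True (j ℕ.≤? 8)} → ∑Fq (λ y → z y ^ j) ≡ 0#
    ∑z^ j {j≤8} = ∑Fq-shift ρ j (ℕ.≤-trans (ℕ.s≤s (toWitness j≤8)) (ℕ.≤-trans (from-yes (9 ℕ.≤? 26)) 26≤p))

    module _ {r} (φr≡r+1 : φ r ≡ r + 1#) where

      -- Every reciprocal power sums to 1, so a principal part sums to the sum of its coefficients.
      -- The bound 6 is the largest pole order that occurs, that of z²h⁶.
      ∑Fq-principal : ∀ j ks → j ℕ.+ length ks ℕ.≤ 6 →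
        ∑Fq (λ y → principal j ks ((y - r) ⁻¹)) ≡ ⟦ foldr _+₃_ 𝟘 ks ⟧₃
      ∑Fq-principal j []       _   = ∑-zero Fq
      ∑Fq-principal j (k ∷ ks) j+≤ = begin
        ∑Fq (λ y → ⟦ k ⟧₃ * ((y - r) ⁻¹) ^ suc j + principal (suc j) ks ((y - r) ⁻¹))
          ≡⟨ ∑-+ Fq _ _ ⟩
        ∑Fq (λ y → ⟦ k ⟧₃ * ((y - r) ⁻¹) ^ suc j) + ∑Fq (λ y → principal (suc j) ks ((y - r) ⁻¹))
          ≡⟨ cong₂ _+_ (trans (∑-* Fq ⟦ k ⟧₃ _) (cong (⟦ k ⟧₃ *_)
               (∑Fq-inverse-power (not-fixed φr≡r+1) φr≡r+1 j (ℕ.≤-trans (ℕ.≤-trans (ℕ.m≤m+n j _) (ℕ.≤-pred 1+j+≤)) 5≤p))))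
             (∑Fq-principal (suc j) ks 1+j+≤) ⟩
        ⟦ k ⟧₃ * 1# + ⟦ foldr _+₃_ 𝟘 ks ⟧₃ ≡⟨ cong (_+ ⟦ foldr _+₃_ 𝟘 ks ⟧₃) (*-identityʳ _) ⟩
        ⟦ k ⟧₃ + ⟦ foldr _+₃_ 𝟘 ks ⟧₃      ≡⟨ ⟦⟧-+ k _ ⟨
        ⟦ k +₃ foldr _+₃_ 𝟘 ks ⟧₃          ∎
        where 1+j+≤ = subst (ℕ._≤ 6) (ℕ.+-suc j (length ks)) j+≤

    ∑Fq-partial-fractions : ∀ {g} αs βs γs
      {α≤6 : True (length αs ℕ.≤? 6)} {β≤6 : True (length βs ℕ.≤? 6)} {γ≤6 : True (length γs ℕ.≤? 6)} →
      (∀ {y} → Fixed y → g y ≡ principal 0 αs (u y) + principal 0 βs (v y) + principal 0 γs (w y)) →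
      ∑Fq g ≡ ⟦ (foldr _+₃_ 𝟘 αs +₃ foldr _+₃_ 𝟘 βs) +₃ foldr _+₃_ 𝟘 γs ⟧₃
    ∑Fq-partial-fractions {g} αs βs γs {α≤6} {β≤6} {γ≤6} eq = begin
      ∑Fq g ≡⟨ ∑Fq-cong eq ⟩
      ∑Fq (λ y → principal 0 αs (u y) + principal 0 βs (v y) + principal 0 γs (w y))
        ≡⟨ trans (∑-+ Fq _ _) (cong (_+ _) (∑-+ Fq _ _)) ⟩
      ∑Fq (λ y → principal 0 αs (u y)) + ∑Fq (λ y → principal 0 βs (v y)) + ∑Fq (λ y → principal 0 γs (w y))
        ≡⟨ cong₂ _+_ (cong₂ _+_ (∑Fq-principal φρ≡ρ+1 0 αs (toWitness α≤6)) (∑Fq-principal φ[ρ+1] 0 βs (toWitness β≤6)))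
             (∑Fq-principal φ[ρ-1] 0 γs (toWitness γ≤6)) ⟩
      ⟦ foldr _+₃_ 𝟘 αs ⟧₃ + ⟦ foldr _+₃_ 𝟘 βs ⟧₃ + ⟦ foldr _+₃_ 𝟘 γs ⟧₃
        ≡⟨ trans (⟦⟧-+ (foldr _+₃_ 𝟘 αs +₃ foldr _+₃_ 𝟘 βs) _) (cong (_+ _) (⟦⟧-+ (foldr _+₃_ 𝟘 αs) _)) ⟨
      ⟦ (foldr _+₃_ 𝟘 αs +₃ foldr _+₃_ 𝟘 βs) +₃ foldr _+₃_ 𝟘 γs ⟧₃ ∎

    ∑z²h : ∑Fq (λ y → z y ^ 2 * h y) ≡ 1#
    ∑z²h = ∑Fq-partial-fractions [] (𝟚 ∷ []) (𝟚 ∷ []) z²h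

    ∑z²h² : ∑Fq (λ y → z y ^ 2 * h y ^ 2) ≡ 1# + 1#
    ∑z²h² = ∑Fq-partial-fractions [] (𝟚 ∷ 𝟙 ∷ []) (𝟙 ∷ 𝟙 ∷ []) z²h²

    ∑z²h³ : ∑Fq (λ y → z y ^ 2 * h y ^ 3) ≡ 1#
    ∑z²h³ = ∑Fq-partial-fractions (𝟚 ∷ []) (𝟚 ∷ 𝟙 ∷ 𝟚 ∷ []) (𝟚 ∷ 𝟚 ∷ 𝟚 ∷ []) z²h³

    ∑z²h⁴ : ∑Fq (λ y → z y ^ 2 * h y ^ 4) ≡ 1#
    ∑z²h⁴ = ∑Fq-partial-fractions (𝟘 ∷ 𝟙 ∷ []) (𝟚 ∷ 𝟚 ∷ 𝟚 ∷ 𝟙 ∷ []) (𝟙 ∷ 𝟚 ∷ 𝟙 ∷ 𝟙 ∷ []) z²h⁴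

    ∑z²h⁶ : ∑Fq (λ y → z y ^ 2 * h y ^ 6) ≡ 1# + 1#
    ∑z²h⁶ = ∑Fq-partial-fractions (𝟘 ∷ 𝟘 ∷ 𝟘 ∷ 𝟙 ∷ []) (𝟘 ∷ 𝟘 ∷ 𝟘 ∷ 𝟙 ∷ 𝟚 ∷ 𝟙 ∷ []) (𝟘 ∷ 𝟘 ∷ 𝟘 ∷ 𝟙 ∷ 𝟙 ∷ 𝟙 ∷ []) z²h⁶

    drop-zero : ∀ {s e} k → e ≡ 1# → s + (e - 1#) * k ≡ s
    drop-zero {s} k refl = solve 2 (λ s k → s :+ (con 𝟙 :- con 𝟙) :* k := s) refl s k

    module _ (b : Carrier) where

      ∑5 : ∑Fq (λ y → (b * z y + h y) ^ 5) ≡ b ^ 2 - b ^ 4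
      ∑5 = begin
        ∑Fq (λ y → (b * z y + h y) ^ 5)
          ≡⟨ ∑Fq-cong (λ {y} y∈ → trans (expand-5 b (z y) (h y)) (trans (drop-zero _ (h*[z³-z]≡1 y∈))
          (solve 8 (λ k₁ g₁ k₂ g₂ k₃ g₃ g₄ g₅ → k₁ :* g₁ :- k₂ :* g₂ :+ k₃ :* g₃ :+ g₄ :+ g₅
            := k₁ :* g₁ :+ (:- k₂ :* g₂ :+ (k₃ :* g₃ :+ (con 𝟙 :* g₄ :+ (con 𝟙 :* g₅ :+ con 𝟘))))) refl (b ^ 5) _ (b ^ 4) _ (b ^ 2) _ _ _))) ⟩
        ∑Fq (combination ts) ≡⟨ ∑Fq-combination ts (∑z^ 5 ∷ ∑z²h ∷ ∑z²h³ ∷ ∑Fq-zF[h] F₁ ∷ ∑Fq-F[h] F₀ ∷ []) ⟩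
        combination-sum ts
          ≡⟨ solve 3 (λ k₁ k₂ k₃ → k₁ :* con 𝟘 :+ (:- k₂ :* con 𝟙 :+ (k₃ :* con 𝟙 :+ (con 𝟙 :* con 𝟘 :+ (con 𝟙 :* con 𝟘 :+ con 𝟘))))
               := k₃ :- k₂) refl (b ^ 5) (b ^ 4) (b ^ 2) ⟩
        b ^ 2 - b ^ 4 ∎
        where
        F₀ F₁ : Carrier → Carrier
        F₀ h = b ^ 3 * h + h ^ 5
        F₁ h = b ^ 3 * h ^ 2 - b ^ 4 - b * h ^ 4
        ts : List Term
        ts = (b ^ 5 , (λ y → z y ^ 5) , 0#) ∷ (- (b ^ 4) , (λ y → z y ^ 2 * h y) , 1#) ∷ (b ^ 2 , (λ y → z y ^ 2 * h y ^ 3) , 1#)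
           ∷ (1# , (λ y → z y * F₁ (h y)) , 0#) ∷ (1# , (λ y → F₀ (h y)) , 0#) ∷ []

      ∑8 : ∑Fq (λ y → (b * z y + h y) ^ 8) ≡ b ^ 5 - b ^ 6 + b ^ 4 - b ^ 2
      ∑8 = begin
        ∑Fq (λ y → (b * z y + h y) ^ 8)
          ≡⟨ ∑Fq-cong (λ {y} y∈ → trans (expand-8 b (z y) (h y)) (trans (drop-zero _ (h*[z³-z]≡1 y∈))
          (solve 13 (λ k₁ g₁ k₂ g₂ g₃ k₄ g₄ k₅ g₅ k₆ g₆ g₇ g₈ → k₁ :* g₁ :- k₂ :* g₂ :- k₂ :* g₃ :+ k₄ :* g₄ :+ k₅ :* g₅ :+ k₆ :* g₆ :+ g₇ :+ g₈
            := k₁ :* g₁ :+ (:- k₂ :* g₂ :+ (:- k₂ :* g₃ :+ (k₄ :* g₄ :+ (k₅ :* g₅ :+ (k₆ :* g₆ :+ (con 𝟙 :* g₇ :+ (con 𝟙 :* g₈ :+ con 𝟘))))))))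
            refl (b ^ 8) _ (b ^ 7) _ _ (b ^ 6 - b ^ 5) _ (b ^ 4) _ (b ^ 2) _ _ _))) ⟩
        ∑Fq (combination ts)
          ≡⟨ ∑Fq-combination ts (∑z^ 8 ∷ ∑z^ 2 ∷ ∑z^ 4 ∷ ∑z²h² ∷ ∑z²h⁴ ∷ ∑z²h⁶ ∷ ∑Fq-zF[h] F₁ ∷ ∑Fq-F[h] F₀ ∷ []) ⟩
        combination-sum ts
          ≡⟨ solve 6 (λ k₁ k₂ k₆ k₅ k₄ k₀ → k₁ :* con 𝟘 :+ (:- k₂ :* con 𝟘 :+ (:- k₂ :* con 𝟘 :+ ((k₆ :- k₅) :* con 𝟚 :+ (k₄ :* con 𝟙
          :+ (k₀ :* con 𝟚 :+ (con 𝟙 :* con 𝟘 :+ (con 𝟙 :* con 𝟘 :+ con 𝟘)))))))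
               := k₅ :- k₆ :+ k₄ :- k₀) refl (b ^ 8) (b ^ 7) (b ^ 6) (b ^ 5) (b ^ 4) (b ^ 2) ⟩
        b ^ 5 - b ^ 6 + b ^ 4 - b ^ 2 ∎
        where
        F₀ F₁ : Carrier → Carrier
        F₀ h = b ^ 6 - b ^ 7 - b ^ 5 * h ^ 2 - b ^ 3 * h ^ 4 + h ^ 8
        F₁ h = b ^ 4 * h ^ 3 - b ^ 7 * h - b ^ 6 * h - b ^ 5 * h ^ 3 - b ^ 3 * h ^ 5 - b * h ^ 7
        ts : List Term
        ts = (b ^ 8 , (λ y → z y ^ 8) , 0#) ∷ (- (b ^ 7) , (λ y → z y ^ 2) , 0#) ∷ (- (b ^ 7) , (λ y → z y ^ 4) , 0#)
           ∷ (b ^ 6 - b ^ 5 , (λ y → z y ^ 2 * h y ^ 2) , 1# + 1#) ∷ (b ^ 4 , (λ y → z y ^ 2 * h y ^ 4) , 1#) ∷ (b ^ 2 , (λ y → z y ^ 2 * h y ^ 6) , 1# + 1#)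
           ∷ (1# , (λ y → z y * F₁ (h y)) , 0#) ∷ (1# , (λ y → F₀ (h y)) , 0#) ∷ []

      -- The fifth powers give b²(1 - b²) = 0, hence b² = 1. Under b² = 1 the relation from the
      -- eighth powers collapses to b - 1 = 0, which settles the sign.
      power-sums-vanish⇒b≡1 : b ≢ 0# → ∑Fq (λ y → (b * z y + h y) ^ 5) ≡ 0# → ∑Fq (λ y → (b * z y + h y) ^ 8) ≡ 0# → b ≡ 1#
      power-sums-vanish⇒b≡1 b≢0 ∑5≡0 ∑8≡0 = x-y≡0⇒x≡y (begin
        b - 1#
          ≡⟨ solve 1 (λ b → b :- con 𝟙
               := (con 𝟙 :* con 𝟙 :* b :- con 𝟙 :* con 𝟙 :* con 𝟙 :+ con 𝟙 :* con 𝟙 :- con 𝟙)) refl b ⟩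
        1# * 1# * b - 1# * 1# * 1# + 1# * 1# - 1# ≡⟨ cong (λ s → s * s * b - s * s * s + s * s - s) b²≡1 ⟨
        b ^ 2 * b ^ 2 * b - b ^ 2 * b ^ 2 * b ^ 2 + b ^ 2 * b ^ 2 - b ^ 2
          ≡⟨ solve 1 (λ b → b :^^ 2 :* b :^^ 2 :* b :- b :^^ 2 :* b :^^ 2 :* b :^^ 2 :+ b :^^ 2 :* b :^^ 2 :- b :^^ 2
            := b :^^ 5 :- b :^^ 6 :+ b :^^ 4 :- b :^^ 2) refl b ⟩
        b ^ 5 - b ^ 6 + b ^ 4 - b ^ 2 ≡⟨ ∑8 ⟨
        ∑Fq (λ y → (b * z y + h y) ^ 8) ≡⟨ ∑8≡0 ⟩
        0# ∎)
        where
        b²≡1 : b ^ 2 ≡ 1#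
        b²≡1 = sym (x-y≡0⇒x≡y (xy≡0∧x≢0⇒y≡0 (begin
          b ^ 2 * (1# - b ^ 2) ≡⟨ solve 1 (λ b → b :^^ 2 :* (con 𝟙 :- b :^^ 2) := b :^^ 2 :- b :^^ 4) refl b ⟩
          b ^ 2 - b ^ 4        ≡⟨ ∑5 ⟨
          ∑Fq (λ y → (b * z y + h y) ^ 5) ≡⟨ ∑5≡0 ⟩
          0# ∎)
          (λ b²≡0 → b≢0 (^-zero b 2 b²≡0))))

    -- Injectivity of y + h by means of X³ - X.

    φz≡z-1 : ∀ {y} → Fixed y → φ (z y) ≡ z y - 1#
    φz≡z-1 {y} y∈ = trans (φ-- y ρ) (trans (cong₂ _-_ y∈ φρ≡ρ+1)
      (solve 2 (λ y r → y :- (r :+ con 𝟙) := y :- r :- con 𝟙) refl y ρ))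

    -- In characteristic 3 this Artin-Schreier polynomial is additive with kernel F₃, and h y =
    -- 1/L(z y) for y in F_q.
    L : Carrier → Carrier
    L x = x * (x * x) - x

    φL : ∀ x → φ (L x) ≡ L (φ x)
    φL x = trans (φ-- _ x) (cong (_- φ x) (trans (φ-* x _) (cong (φ x *_) (φ-* x x))))

    L-fixed : ∀ {x} → Fixed x → Fixed (L x)
    L-fixed x∈ = fixed-- (fixed-* x∈ (fixed-* x∈ x∈)) x∈

    -- The q-th power moves z by -1, an element of the kernel of `L`.
    Lz-fixed : ∀ {y} → Fixed y → Fixed (L (z y))
    Lz-fixed {y} y∈ = trans (φL (z y)) (trans (cong L (φz≡z-1 y∈))
      (solve 1 (λ z → (z :- con 𝟙) :* ((z :- con 𝟙) :* (z :- con 𝟙)) :- (z :- con 𝟙)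
           := z :* (z :* z) :- z) refl (z y)))

    L≡0⇒fixed : ∀ {x} → L x ≡ 0# → Fixed x
    L≡0⇒fixed {x} Lx≡0 = cube-fixed⇒frobenius-fixed n
      (trans (cong (λ t → x * (x * t)) (*-identityʳ x)) (x-y≡0⇒x≡y Lx≡0))

    -- Equality would put z - x in the kernel of `L`, hence in F_q, and with it ρ = y - x - (z - x).
    Lz∉L[Fq] : ∀ {y x} → Fixed y → Fixed x → L (z y) ≢ L x
    Lz∉L[Fq] {y} {x} y∈ x∈ eq = not-fixed φρ≡ρ+1 (subst Fixed
      (solve 3 (λ y r x → y :- x :- (y :- r :- x) := r) refl y ρ x)
      (fixed-- (fixed-- y∈ x∈) (L≡0⇒fixed (trans
        (solve 2 (λ z x → (z :- x) :* ((z :- x) :* (z :- x)) :- (z :- x)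
             := (z :* (z :* z) :- z) :- (x :* (x :* x) :- x)) refl (z y) x)
        (x≡y⇒x-y≡0 eq)))))

    -- With t = y - y′ and m = L(z y′), equality of values gives m (m + L t) = t² - 1, whose discriminant
    -- in m is (t² - 1)(t² + 1)²; a root in F_q is therefore of the form L (t - e) with e² = t² - 1.
    y+h-injective : ∀ {y y′} → Fixed y → Fixed y′ → y + h y ≡ y′ + h y′ → y ≡ y′
    y+h-injective {y} {y′} y∈ y′∈ eq with (y - y′) ≟ 0#
    ... | yes t≡0 = x-y≡0⇒x≡y t≡0
    ... | no  t≢0 = contradiction m≡L[t-e] (Lz∉L[Fq] y′∈ (fixed-- t∈ e∈))
      where
      t m s : Carrier
      t = y - y′
      m = L (z y′)
      -- The derivative in m of m(m + L t), so that s² is the discriminant.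
      s = m + m + L t

      t∈ : Fixed t
      t∈ = fixed-- y∈ y′∈

      Lz≡m+Lt : L (z y) ≡ m + L t
      Lz≡m+Lt = solve 3 (λ y y′ r → let z = y :- r; z′ = y′ :- r; t = y :- y′ in
        z :* (z :* z) :- z := (z′ :* (z′ :* z′) :- z′) :+ (t :* (t :* t) :- t)) refl y y′ ρ

      -- Equal values mean t = 1/m - 1/(m + L t). Clearing denominators leaves L t = t(t² - 1) on
      -- the right; the common factor t is cancelled afterwards.
      t*[mm′]≡t*[t²-1] : t * (m * (m + L t)) ≡ t * (t * t - 1#)
      t*[mm′]≡t*[t²-1] = begin
        t * (m * (m + L t))                      ≡⟨ cong (_* (m * (m + L t))) t≡h′-h ⟩
        (h y′ - h y) * (m * (m + L t))
          ≡⟨ solve 4 (λ h h′ m l → (h′ :- h) :* (m :* l)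
               := (h′ :* m) :* l :- (h :* l) :* m) refl (h y) (h y′) m (m + L t) ⟩
        (h y′ * m) * (m + L t) - (h y * (m + L t)) * m ≡⟨ cong₂ (λ i j → i * (m + L t) - j * m) (h*[z³-z]≡1 y′∈)
                                                     (trans (cong (h y *_) (sym Lz≡m+Lt)) (h*[z³-z]≡1 y∈)) ⟩
        1# * (m + L t) - 1# * m
          ≡⟨ solve 2 (λ m t → con 𝟙 :* (m :+ (t :* (t :* t) :- t)) :- con 𝟙 :* m := t :* (t :* t :- con 𝟙)) refl m t ⟩
        t * (t * t - 1#)                         ∎
        where
        t≡h′-h : t ≡ h y′ - h y
        t≡h′-h = begin
          y - y′                   ≡⟨ solve 3 (λ y y′ h → y :- y′ := (y :+ h) :- y′ :- h) refl y y′ (h y) ⟩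
          (y + h y) - y′ - h y     ≡⟨ cong (λ i → i - y′ - h y) eq ⟩
          (y′ + h y′) - y′ - h y   ≡⟨ solve 3 (λ y′ h h′ → (y′ :+ h′) :- y′ :- h := h′ :- h) refl y′ (h y) (h y′) ⟩
          h y′ - h y               ∎

      s²≡ : s * s ≡ (t * t - 1#) * ((t * t + 1#) * (t * t + 1#))
      s²≡ = begin
        s * s ≡⟨ solve 2 (λ m l → (m :+ m :+ l) :* (m :+ m :+ l) := m :* (m :+ l) :+ l :* l) refl m (L t) ⟩
        m * (m + L t) + L t * L t ≡⟨ cong (_+ L t * L t) (*-cancel-nonzeroˡ t≢0 t*[mm′]≡t*[t²-1]) ⟩
        (t * t - 1#) + L t * L t ≡⟨ solve 1 (λ t → let l = t :* (t :* t) :- t in (t :* t :- con 𝟙) :+ l :* l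
            := (t :* t :- con 𝟙) :* ((t :* t :+ con 𝟙) :* (t :* t :+ con 𝟙))) refl t ⟩
        (t * t - 1#) * ((t * t + 1#) * (t * t + 1#)) ∎

      s∈ : Fixed s
      s∈ = fixed-+ (fixed-+ (Lz-fixed y′∈) (Lz-fixed y′∈)) (L-fixed t∈)

      root : ∃[ e ] (Fixed e × L e ≡ s)
      root with (t * t + 1#) ≟ 0#
      -- The discriminant vanishes here, so s = 0 = L 0.
      ... | yes t²+1≡0 = 0# , φ-0 , trans (solve 0 (con 𝟘 :* (con 𝟘 :* con 𝟘) :- con 𝟘 := con 𝟘) refl)
        (sym (^-zero s 2 (trans (cong (s *_) (*-identityʳ s)) (trans s²≡
          (trans (cong (λ k → (t * t - 1#) * (k * k)) t²+1≡0)
            (solve 1 (λ k → k :* (con 𝟘 :* con 𝟘) := con 𝟘) refl (t * t - 1#)))))))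
      -- With e = s/(t² + 1) the discriminant formula gives e² = t² - 1. Then L e = e(e² - 1) = e(t²
      -- - 2), and -2 = 1 makes this e(t² + 1) = s.
      ... | no  t²+1≢0 = e , fixed-* s∈ (fixed-⁻¹ k∈) , (begin
          e * (e * e) - e             ≡⟨ solve 1 (λ e → e :* (e :* e) :- e := e :* (e :* e :- con 𝟙)) refl e ⟩
          e * (e * e - 1#)            ≡⟨ cong (λ i → e * (i - 1#)) e²≡t²-1 ⟩
          e * (t * t - 1# - 1#)
            ≡⟨ solve 2 (λ e t → e :* (t :* t :- con 𝟙 :- con 𝟙) := e :* (t :* t :+ con 𝟙)) refl e t ⟩
          e * k                       ≡⟨ ek≡s ⟩
          s                           ∎)
        where
        k e : Carrier
        k = t * t + 1#
        e = s * k ⁻¹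
        k∈ : Fixed k
        k∈ = fixed-+ (fixed-* t∈ t∈) φ-1
        ek≡s : e * k ≡ s
        ek≡s = trans (*-assoc _ _ _) (trans (cong (s *_) (trans (*-comm _ _) (⁻¹-inverse k t²+1≢0))) (*-identityʳ s))
        e²≡t²-1 : e * e ≡ t * t - 1#
        e²≡t²-1 = *-cancel-nonzeroˡ (*-nonzero t²+1≢0 t²+1≢0) (begin
          k * k * (e * e)                ≡⟨ solve 2 (λ k e → k :* k :* (e :* e) := (e :* k) :* (e :* k)) refl k e ⟩
          (e * k) * (e * k)              ≡⟨ cong (λ i → i * i) ek≡s ⟩
          s * s                          ≡⟨ s²≡ ⟩
          (t * t - 1#) * (k * k)         ≡⟨ *-comm _ _ ⟩
          k * k * (t * t - 1#)           ∎)

      e : Carrier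
      e = proj₁ root

      e∈ : Fixed e
      e∈ = proj₁ (proj₂ root)

      m≡L[t-e] : m ≡ L (t - e)
      m≡L[t-e] = begin
        -- L t - s = -2m, which is m modulo 3.
        m                 ≡⟨ solve 2 (λ m l → m := l :- (m :+ m :+ l)) refl m (L t) ⟩
        L t - s           ≡⟨ cong (λ i → L t - i) (proj₂ (proj₂ root)) ⟨
        L t - L e
          ≡⟨ solve 2 (λ t e → (t :* (t :* t) :- t) :- (e :* (e :* e) :- e)
               := (t :- e) :* ((t :- e) :* (t :- e)) :- (t :- e)) refl t e ⟩
        L (t - e)         ∎

  -- The given map on F_q, and the vanishing of the trace.

  module Map {a r : Carrier} (a∈ : Fixed a) (a≢0 : a ≢ 0#) (r∉ : ¬ Fixed r) where

    open Setup K q a r using (r₁; r₂; r₃; f; InP1Fq; IsPermutationP1Fq)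

    φr₂≡r₃ : φ r₂ ≡ r₃
    φr₂≡r₃ = sym (^-* r q q)

    φr₃≡r₁ : φ r₃ ≡ r₁
    φr₃≡r₁ = trans (cong φ (sym φr₂≡r₃)) (φ³≡id r)

    r₂∉ : ¬ Fixed r₂
    r₂∉ φr₂≡r₂ = r∉ (begin
      φ r       ≡⟨ φr₂≡r₂ ⟨
      φ r₂      ≡⟨ cong φ φr₂≡r₂ ⟨
      φ (φ r₂)  ≡⟨ φ³≡id r ⟩
      r         ∎)

    r₃∉ : ¬ Fixed r₃
    r₃∉ φr₃≡r₃ = r∉ (subst Fixed (trans (sym φr₃≡r₃) φr₃≡r₁) φr₃≡r₃)

    value : Carrier → Carrier
    value x = a * x + (x - r₁) ⁻¹ + (x - r₂) ⁻¹ + (x - r₃) ⁻¹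

    -- All three poles lie outside F_q, so no point of F_q is sent to ∞.
    f-just : ∀ {x} → Fixed x → f (just x) ≡ just (value x)
    f-just {x} x∈ with x ≟ r₁ | x ≟ r₂ | x ≟ r₃
    ... | yes refl | _        | _        = contradiction x∈ r∉
    ... | no _     | yes refl | _        = contradiction x∈ r₂∉
    ... | no _     | no _     | yes refl = contradiction x∈ r₃∉
    ... | no _     | no _     | no _     = refl

    -- The q-th power permutes the three reciprocals cyclically.
    value-fixed : ∀ {x} → Fixed x → Fixed (value x)
    value-fixed {x} x∈ = begin
      φ (value x)
        ≡⟨ trans (φ-+ _ _) (cong₂ _+_ (trans (φ-+ _ _) (cong₂ _+_ (trans (φ-+ _ _) (cong₂ _+_
             (fixed-* a∈ x∈) (move refl))) (move φr₂≡r₃))) (move φr₃≡r₁)) ⟩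
      a * x + (x - r₂) ⁻¹ + (x - r₃) ⁻¹ + (x - r₁) ⁻¹
        ≡⟨ solve 4 (λ i j k l → i :+ j :+ k :+ l := i :+ l :+ j :+ k) refl (a * x) _ _ _ ⟩
      value x ∎
      where
      move : ∀ {s t} → φ s ≡ t → φ ((x - s) ⁻¹) ≡ (x - t) ⁻¹
      move {s} refl = trans (φ-⁻¹ _) (cong _⁻¹ (trans (φ-- x s) (cong (_- φ s) x∈)))

    module _ (perm : IsPermutationP1Fq) where

      permutation⇒injective : ∀ {x y} → Fixed x → Fixed y → value x ≡ value y → x ≡ y
      permutation⇒injective {x} {y} x∈ y∈ eq with proj₂ perm (just (value x)) (value-fixed x∈)
      ... | P , _ , _ , unique = just-injective (trans
        (unique (just x) x∈ (f-just x∈))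
        (sym (unique (just y) y∈ (trans (f-just y∈) (cong just (sym eq))))))

      permutation⇒surjective : ∀ {x} → Fixed x → ∃[ y ] (Fixed y × value y ≡ x)
      permutation⇒surjective {x} x∈ with proj₂ perm (just x) x∈
      ... | nothing , _  , ()
      ... | just y  , y∈ , eq , _ = y , y∈ , just-injective (trans (sym (f-just y∈)) eq)

      ∑Fq-value : ∀ g → ∑Fq (λ x → g (value x)) ≡ ∑Fq g
      ∑Fq-value g = ∑-permute value g (unique-same-elements⇒↭
        (unique-map⁺ value (λ x∈ y∈ → permutation⇒injective (∈⇒fixed x∈) (∈⇒fixed y∈)) Fq-unique)
        Fq-unique
        (λ z∈ → let (y , y∈ , z≡) = ∈-map⁻ value z∈ in subst (_∈ Fq) (sym z≡) (fixed⇒∈ (value-fixed (∈⇒fixed y∈))))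
        (λ z∈ → let (y , y∈ , eq) = permutation⇒surjective (∈⇒fixed z∈) in subst (_∈ map value Fq) eq (∈-map⁺ value (fixed⇒∈ y∈))))

      -- The sum of the values is 1/D₁ + 1/D₂ + 1/D₃ for the three differences of conjugates.
      -- Cleared of denominators it is D₂D₃ + D₁D₃ + D₁D₂, which equals -(r₁ + r₂ + r₃)² modulo 3.
      trace-zero : r₁ + r₂ + r₃ ≡ 0#
      trace-zero = ^-zero _ 2 (begin
        (r₁ + r₂ + r₃) ^ 2
          ≡⟨ solve 3 (λ r₁ r₂ r₃ → let D₁ = r₂ :- r₁; D₂ = r₃ :- r₂; D₃ = r₁ :- r₃ in
               (r₁ :+ r₂ :+ r₃) :^^ 2
                    := :- (D₂ :* D₃ :* con 𝟙 :+ D₁ :* D₃ :* con 𝟙 :+ D₁ :* D₂ :* con 𝟙)) refl r₁ r₂ r₃ ⟩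
        - (D₂ * D₃ * 1# + D₁ * D₃ * 1# + D₁ * D₂ * 1#)
          ≡⟨ cong₂ (λ s t → - (s + D₁ * D₂ * t)) (cong₂ (λ s t → D₂ * D₃ * s + D₁ * D₃ * t) D₁A₁ D₂A₂) D₃A₃ ⟨
        - (D₂ * D₃ * (D₁ * A r₁) + D₁ * D₃ * (D₂ * A r₂) + D₁ * D₂ * (D₃ * A r₃))
          ≡⟨ solve 7 (λ D₁ D₂ D₃ A₁ A₂ A₃ a → :- (D₂ :* D₃ :* (D₁ :* A₁) :+ D₁ :* D₃ :* (D₂ :* A₂) :+ D₁ :* D₂ :* (D₃ :* A₃))
               := :- (D₁ :* D₂ :* D₃ :* (a :* con 𝟘 :+ A₁ :+ A₂ :+ A₃))) refl D₁ D₂ D₃ (A r₁) (A r₂) (A r₃) a ⟩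
        - (D₁ * D₂ * D₃ * (a * 0# + A r₁ + A r₂ + A r₃))
          ≡⟨ cong (λ t → - (D₁ * D₂ * D₃ * (a * t + A r₁ + A r₂ + A r₃))) ∑x≡0 ⟨
        - (D₁ * D₂ * D₃ * (a * ∑Fq (λ x → x) + A r₁ + A r₂ + A r₃))
          ≡⟨ cong (λ t → - (D₁ * D₂ * D₃ * t)) (sym ∑value≡) ⟩
        - (D₁ * D₂ * D₃ * ∑Fq value)
          ≡⟨ cong (λ t → - (D₁ * D₂ * D₃ * t)) (trans (∑Fq-value (λ x → x)) ∑x≡0) ⟩
        - (D₁ * D₂ * D₃ * 0#)
          ≡⟨ solve 1 (λ D → :- (D :* con 𝟘) := con 𝟘) refl (D₁ * D₂ * D₃) ⟩
        0# ∎)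
        where
        A : Carrier → Carrier
        A s = ∑Fq (λ x → (x - s) ⁻¹)
        D₁ D₂ D₃ : Carrier
        D₁ = r₂ - r₁
        D₂ = r₃ - r₂
        D₃ = r₁ - r₃
        D₁A₁ : D₁ * A r₁ ≡ 1#
        D₁A₁ = ∑Fq-inverse r∉
        D₂A₂ : D₂ * A r₂ ≡ 1#
        D₂A₂ = trans (cong (λ t → (t - r₂) * A r₂) (sym φr₂≡r₃)) (∑Fq-inverse r₂∉)
        D₃A₃ : D₃ * A r₃ ≡ 1#
        D₃A₃ = trans (cong (λ t → (t - r₃) * A r₃) (sym φr₃≡r₁)) (∑Fq-inverse r₃∉)
        ∑x≡0 : ∑Fq (λ x → x) ≡ 0#
        ∑x≡0 = trans (∑Fq-cong (λ {x} _ → sym (*-identityʳ x))) (∑Fq-^ 1 (ℕ.≤-trans (from-yes (2 ℕ.≤? 26)) 26≤p))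
        ∑value≡ : ∑Fq value ≡ a * ∑Fq (λ x → x) + A r₁ + A r₂ + A r₃
        ∑value≡ = trans (∑-+ Fq _ _) (cong (_+ A r₃) (trans (∑-+ Fq _ _) (cong (_+ A r₂)
          (trans (∑-+ Fq _ _) (cong (_+ A r₁) (∑-* Fq a (λ x → x)))))))

    -- Trace zero: reduction to the normalised map.

    module TraceZero (∑r≡0 : r₁ + r₂ + r₃ ≡ 0#) where

      δ ρ b : Carrier
      δ = r₂ - r₁
      ρ = r * δ ⁻¹
      b = - (a * (δ * δ))

      -- In characteristic 3, trace zero means that the conjugates form an arithmetic progression r
      -- - δ, r, r + δ.
      r₃≡r-δ : r₃ ≡ r - δ
      r₃≡r-δ = begin
        r₃
          ≡⟨ solve 3 (λ r₁ r₂ r₃ → r₃ := (r₁ :+ r₂ :+ r₃) :+ (r₁ :- (r₂ :- r₁))) refl r₁ r₂ r₃ ⟩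
        (r₁ + r₂ + r₃) + (r - δ)   ≡⟨ cong (_+ (r - δ)) ∑r≡0 ⟩
        0# + (r - δ)               ≡⟨ +-identityˡ _ ⟩
        r - δ                      ∎

      δ≢0 : δ ≢ 0#
      δ≢0 δ≡0 = r∉ (x-y≡0⇒x≡y δ≡0)

      -- The next difference of conjugates is r₃ - r₂ = -2δ, which is δ again.
      δ∈ : Fixed δ
      δ∈ = begin
        φ (r₂ - r₁)   ≡⟨ φ-- r₂ r₁ ⟩
        φ r₂ - r₂     ≡⟨ cong (_- r₂) (trans φr₂≡r₃ r₃≡r-δ) ⟩
        r - δ - r₂    ≡⟨ solve 2 (λ r₁ r₂ → r₁ :- (r₂ :- r₁) :- r₂ := r₂ :- r₁) refl r₁ r₂ ⟩
        δ             ∎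

      δρ≡r : δ * ρ ≡ r
      δρ≡r = trans (solve 3 (λ d r i → d :* (r :* i) := r :* (d :* i)) refl δ r (δ ⁻¹))
        (trans (cong (r *_) (⁻¹-inverse δ δ≢0)) (*-identityʳ r))

      φρ≡ρ+1 : φ ρ ≡ ρ + 1#
      φρ≡ρ+1 = begin
        φ (r * δ ⁻¹)          ≡⟨ trans (φ-* r (δ ⁻¹)) (cong (φ r *_) (fixed-⁻¹ δ∈)) ⟩
        r₂ * δ ⁻¹             ≡⟨ solve 3 (λ r₁ r₂ i → r₂ :* i := r₁ :* i :+ (r₂ :- r₁) :* i) refl r₁ r₂ (δ ⁻¹) ⟩
        ρ + δ * δ ⁻¹          ≡⟨ cong (ρ +_) (⁻¹-inverse δ δ≢0) ⟩
        ρ + 1#                ∎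

      open Normalised φρ≡ρ+1

      scaled-inverse : ∀ {s t} → δ * s ≡ t → t ≢ 0# → δ * t ⁻¹ ≡ s ⁻¹
      scaled-inverse {s} {t} δs≡t t≢0 = ⁻¹-unique (begin
        s * (δ * t ⁻¹)   ≡⟨ solve 3 (λ s d i → s :* (d :* i) := (d :* s) :* i) refl s δ (t ⁻¹) ⟩
        (δ * s) * t ⁻¹   ≡⟨ cong (_* t ⁻¹) δs≡t ⟩
        t * t ⁻¹         ≡⟨ ⁻¹-inverse t t≢0 ⟩
        1#               ∎)

      -- Scaling by δ carries ρ, ρ + 1, ρ - 1 to the three conjugates of r. The minus sign matches
      -- the one in h = -(u + v + w) and is the source of the sign in `b`.
      normalise : ∀ {y} → Fixed y → - δ * value (δ * y) ≡ b * y + h y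
      normalise {y} y∈ = begin
        - δ * value (δ * y)
          ≡⟨ solve 6 (λ d a y u v w → :- d :* (a :* (d :* y) :+ u :+ v :+ w)
               := :- (a :* (d :* d)) :* y :+ :- (d :* u :+ d :* v :+ d :* w))
               refl δ a y _ _ _ ⟩
        b * y + - (δ * (δ * y - r₁) ⁻¹ + δ * (δ * y - r₂) ⁻¹ + δ * (δ * y - r₃) ⁻¹)
          ≡⟨ cong (λ t → b * y + - t) (cong₂ _+_ (cong₂ _+_
               (scaled-inverse δz≡ (fixed-≢ δy∈ r∉))
               (scaled-inverse (trans (solve 3 (λ d y ρ → d :* (y :- (ρ :+ con 𝟙)) := d :* (y :- ρ) :- d) refl δ y ρ)
                 (trans (cong (_- δ) δz≡) (solve 3 (λ x r₁ r₂ → x :- r₁ :- (r₂ :- r₁)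
                      := x :- r₂) refl (δ * y) r₁ r₂)))
                 (fixed-≢ δy∈ r₂∉)))
               (scaled-inverse (trans (solve 3 (λ d y ρ → d :* (y :- (ρ :- con 𝟙)) := d :* (y :- ρ) :+ d) refl δ y ρ)
                 (trans (cong (_+ δ) δz≡) (trans (solve 3 (λ x r d → x :- r :+ d := x :- (r :- d)) refl (δ * y) r δ)
                   (cong (λ t → δ * y - t) (sym r₃≡r-δ)))))
                 (fixed-≢ δy∈ r₃∉))) ⟩
        b * y + h y ∎
        where
        δy∈ : Fixed (δ * y)
        δy∈ = fixed-* δ∈ y∈
        δz≡ : δ * (y - ρ) ≡ δ * y - r
        δz≡ = trans (solve 3 (λ d y ρ → d :* (y :- ρ) := d :* y :- d :* ρ) refl δ y ρ) (cong (λ t → δ * y - t) δρ≡r)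

      -δ≢0 : - δ ≢ 0#
      -δ≢0 -δ≡0 = δ≢0 (trans (solve 1 (λ d → d
           := :- (:- d)) refl δ) (trans (cong -_ -δ≡0) (solve 0 (:- con 𝟘 := con 𝟘) refl)))

      [r₁-r₂]²≡δ² : (r₁ - r₂) ^ 2 ≡ δ * δ
      [r₁-r₂]²≡δ² = solve 2 (λ r₁ r₂ → (r₁ :- r₂) :^^ 2 := (r₂ :- r₁) :* (r₂ :- r₁)) refl r₁ r₂

      coefficient : IsPermutationP1Fq → a ≡ - ((r₁ - r₂) ^ 2) ⁻¹
      coefficient perm = begin
        a                      ≡⟨ solve 1 (λ a → a := :- (:- a)) refl a ⟩
        - (- a)                ≡⟨ cong -_ (⁻¹-unique (begin
          (r₁ - r₂) ^ 2 * - a    ≡⟨ cong (_* - a) [r₁-r₂]²≡δ² ⟩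
          δ * δ * - a            ≡⟨ solve 2 (λ d a → d :* d :* :- a := :- (a :* (d :* d))) refl δ a ⟩
          b                      ≡⟨ power-sums-vanish⇒b≡1 b b≢0 (power-sum 5 (from-yes (5 ℕ.≤? 25))) (power-sum 8 (from-yes (8 ℕ.≤? 25))) ⟩
          1#                     ∎)) ⟩
        - ((r₁ - r₂) ^ 2) ⁻¹   ∎
        where
        b≢0 : b ≢ 0#
        b≢0 b≡0 = *-nonzero a≢0 (*-nonzero δ≢0 δ≢0) (trans (solve 1 (λ t → t := :- (:- t)) refl (a * (δ * δ)))
          (trans (cong -_ b≡0) (solve 0 (:- con 𝟘 := con 𝟘) refl)))
        -- The bound 25 is 27 - 2, which keeps `k` below q - 1 already for the smallest q. The
        -- constant bρ need not lie in F_q, since sums of (x - s)^k vanish for every s in K.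
        power-sum : ∀ k → k ℕ.≤ 25 → ∑Fq (λ y → (b * z y + h y) ^ k) ≡ 0#
        power-sum k k≤25 = begin
          ∑Fq (λ y → (b * z y + h y) ^ k)                      ≡⟨ ∑Fq-cong (λ {y} y∈ → cong (_^ k) (trans
               (solve 4 (λ b y ρ h → b :* (y :- ρ) :+ h := (b :* y :+ h) :- b :* ρ) refl b y ρ (h y))
               (cong (_- b * ρ) (sym (normalise y∈))))) ⟩
          ∑Fq (λ y → (- δ * value (δ * y) - b * ρ) ^ k)
            ≡⟨ ∑Fq-scale (λ x → (- δ * value x - b * ρ) ^ k) δ∈ δ≢0 ⟩
          ∑Fq (λ x → (- δ * value x - b * ρ) ^ k)              ≡⟨ ∑Fq-value perm (λ x → (- δ * x - b * ρ) ^ k) ⟩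
          ∑Fq (λ x → (- δ * x - b * ρ) ^ k)
            ≡⟨ ∑Fq-scale (λ x → (x - b * ρ) ^ k) (fixed-neg δ∈) -δ≢0 ⟩
          ∑Fq (λ x → (x - b * ρ) ^ k)                          ≡⟨ ∑Fq-shift (b * ρ) k (ℕ.≤-trans (ℕ.s≤s k≤25) 26≤p) ⟩
          0#                                                   ∎

      module _ (a≡ : a ≡ - ((r₁ - r₂) ^ 2) ⁻¹) where

        b≡1 : b ≡ 1#
        b≡1 = begin
          - (a * (δ * δ))
            ≡⟨ cong (λ t → - (t * (δ * δ))) (trans a≡ (cong (λ t → - t ⁻¹) [r₁-r₂]²≡δ²)) ⟩
          - (- (δ * δ) ⁻¹ * (δ * δ))
            ≡⟨ solve 2 (λ i s → :- (:- i :* s) := s :* i) refl ((δ * δ) ⁻¹) (δ * δ) ⟩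
          (δ * δ) * (δ * δ) ⁻¹                 ≡⟨ ⁻¹-inverse _ (*-nonzero δ≢0 δ≢0) ⟩
          1#                                   ∎

        value-injective : ∀ {x x′} → Fixed x → Fixed x′ → value x ≡ value x′ → x ≡ x′
        value-injective {x} {x′} x∈ x′∈ eq = *-cancel-nonzeroˡ (⁻¹-nonzero δ≢0)
          (y+h-injective (fixed-* δ⁻¹∈ x∈) (fixed-* δ⁻¹∈ x′∈)
            (trans (sym (scaled x∈)) (trans (cong (- δ *_) eq) (scaled x′∈))))
          where
          δ⁻¹∈ = fixed-⁻¹ δ∈
          scaled : ∀ {x} → Fixed x → - δ * value x ≡ δ ⁻¹ * x + h (δ ⁻¹ * x)
          scaled {x} x∈ = begin
            - δ * value x                    ≡⟨ cong (λ t → - δ * value t) (sym (x*[x⁻¹*y]≡y δ≢0 x)) ⟩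
            - δ * value (δ * (δ ⁻¹ * x))     ≡⟨ normalise (fixed-* δ⁻¹∈ x∈) ⟩
            b * (δ ⁻¹ * x) + h (δ ⁻¹ * x)
              ≡⟨ cong (_+ h (δ ⁻¹ * x)) (trans (cong (_* (δ ⁻¹ * x)) b≡1) (*-identityˡ _)) ⟩
            δ ⁻¹ * x + h (δ ⁻¹ * x)          ∎

        -- A missed `x`, put in front of the list of values, would give a repetition-free list
        -- inside F_q that is longer than F_q.
        value-surjective : ∀ {x} → Fixed x → ∃[ y ] (Fixed y × value y ≡ x)
        value-surjective {x} x∈ with any? (λ y → value y ≟ x) Fq
        ... | yes found = let (y , y∈ , eq) = find found in y , ∈⇒fixed y∈ , eq
        ... | no  ¬found = contradiction
          (unique-⊆⇒length-≤ {xs = x ∷ map value Fq} {ys = Fq}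
            (All.tabulate (λ z∈ x≡z → let (y , y∈ , z≡) = ∈-map⁻ value z∈ in ¬found (lose y∈ (sym (trans x≡z z≡))))
              ∷ unique-map⁺ value (λ y∈ y′∈ → value-injective (∈⇒fixed y∈) (∈⇒fixed y′∈)) Fq-unique)
            (λ { (here refl) → fixed⇒∈ x∈
               ; (there z∈)  → let (y , y∈ , z≡) = ∈-map⁻ value z∈ in subst (_∈ Fq) (sym z≡) (fixed⇒∈ (value-fixed (∈⇒fixed y∈))) }))
          (ℕ.<⇒≱ (ℕ.≤-reflexive (cong suc (sym (length-map value Fq)))))

        permutation : IsPermutationP1Fq
        permutation = stable , bijective
          where
          stable : ∀ P → InP1Fq P → InP1Fq (f P)
          stable nothing  _  = _
          stable (just x) x∈ = subst InP1Fq (sym (f-just x∈)) (value-fixed x∈)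

          bijective : ∀ Q → InP1Fq Q → ∃[ P ] (InP1Fq P × f P ≡ Q × (∀ P′ → InP1Fq P′ → f P′ ≡ Q → P′ ≡ P))
          bijective nothing  _  = nothing , _ , refl , unique
            where
            unique : ∀ P′ → InP1Fq P′ → f P′ ≡ nothing → P′ ≡ nothing
            unique nothing  _  _  = refl
            unique (just y) y∈ eq with trans (sym (f-just y∈)) eq
            ... | ()
          bijective (just x) x∈ with value-surjective x∈
          ... | y , y∈ , eq = just y , y∈ , trans (f-just y∈) (cong just eq) , unique
            where
            unique : ∀ P′ → InP1Fq P′ → f P′ ≡ just x → P′ ≡ just y
            unique (just y′) y′∈ eq′ = cong just (value-injective y′∈ y∈
              (trans (just-injective (trans (sym (f-just y′∈)) eq′)) (sym eq)))

    only-if : IsPermutationP1Fq → r₁ + r₂ + r₃ ≡ 0# × a ≡ - ((r₁ - r₂) ^ 2) ⁻¹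
    only-if perm = trace-zero perm , TraceZero.coefficient (trace-zero perm) perm

    if : r₁ + r₂ + r₃ ≡ 0# × a ≡ - ((r₁ - r₂) ^ 2) ⁻¹ → IsPermutationP1Fq
    if (∑r≡0 , a≡) = TraceZero.permutation ∑r≡0 a≡

open import Data.Nat using (_≤_; _^_; _*_)

theorem4p5 : ∀ {c : Level} (n : ℕ) → 3 ≤ n →
  (K : Field c) → HasCardinality K (3 ^ (3 * n)) →
  (a r : Field.Carrier K) →
  Setup.InFq K (3 ^ n) a r a → ¬ (a ≡ Field.0# K) →
  ¬ Setup.InFq K (3 ^ n) a r r →
  (Setup.IsPermutationP1Fq K (3 ^ n) a r
    ⇔ ((Field._+_ K (Field._+_ K (Setup.r₁ K (3 ^ n) a r) (Setup.r₂ K (3 ^ n) a r)) (Setup.r₃ K (3 ^ n) a r) ≡ Field.0# K)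
       × (a ≡ Field.-_ K (Field._⁻¹ K (Field._^_ K (Field._-_ K (Setup.r₁ K (3 ^ n) a r) (Setup.r₂ K (3 ^ n) a r)) 2)))))
theorem4p5 n 3≤n K card a r a∈ a≢0 r∉ = mk⇔ only-if if
  where
  open CubicExtension K n 3≤n card
  open Map a∈ a≢0 r∉
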